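{- Let $H$ be a connected hypergraph with maximum degree $\Delta(H)=\Delta\ge1$ such that $H$ is not $tK_n$ for any $t,n\ge1$ and not $tC_n$ for any $t\ge1$ and odd $n\ge3$. Let $k_1,\dots,k_p$ be positive integers, $p\ge2$, with $k_1+\cdots+k_p\ge\Delta$. Then there is a $p$-partition $(H_1,\dots,H_p)$ of $H$ such that $\mathrm{col}(H_i)\le k_i$ and $\Delta(H_i)\le k_i$ for all $1\le i\le p$.
   Context: A hypergraph $H=(V,E,i)$ consists of finite sets $V(H)$, $E(H)$ and an incidence function $i_H:E\to 2^V$ with $|i(e)|\ge 2$ (parallel edges allowed; edges with $|i(e)|=2$ are ordinary). $H[X]$ is the subhypergraph with vertex set $X$ and edges $e$ with $i_H(e)\subseteq X$ (induced subhypergraph). The degree $d_G(v)$ is the number of edges of $G$ incident with $v$; $\Delta(G)$ is the maximum degree (and $0$ for the empty hypergraph). $H$ is connected if nonempty and for every $\emptyset\ne X\subsetneq V(H)$ some edge meets both $X$ and its complement. A hypergraph is strictly $k$-degenerate if every nonempty subhypergraph has a vertex of degree (in that subhypergraph) less than $k$; $\mathrm{col}(H)$ is the smallest $k$ such that $H$ is strictly $k$-degenerate. A $p$-partition is a sequence of $p$ pairwise vertex-disjoint, possibly empty, induced subhypergraphs whose vertex sets cover $V(H)$. $tK_n$: $n$ vertices, each pair joined by exactly $t$ parallel ordinary edges, no other edges; $tC_n$ ($n\ge3$): cycle of length $n$ with each edge replaced by $t$ parallel ordinary edges. -}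

module Defs where

open import Data.Nat using (ℕ; zero; suc; _+_; _≤_; _<_; _≥_; _%_)
open import Data.Nat.Properties using ()
open import Data.Bool using (Bool; true; false)
open import Data.Bool.Properties using () renaming (_≟_ to _≟ᵇ_)
open import Data.Fin using (Fin; toℕ) renaming (_≟_ to _≟ᶠ_)
open import Data.Fin.Subset using (Subset; _∈_; _∉_; _⊆_; _∩_; _∪_; ∣_∣; ⁅_⁆; Nonempty)
open import Data.Vec using (Vec; tabulate; lookup)
open import Data.Vec.Properties using (≡-dec)
open import Data.List using (List; map; allFin)
open import Data.Nat.ListAction using (sum)
open import Data.Product using (Σ; ∃; ∃-syntax; _×_; _,_)
open import Data.Sum using (_⊎_)
open import Relation.Nullary using (¬_; does)
open import Relation.Binary.PropositionalEquality using (_≡_; _≢_)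
open import Function.Bundles using (_⤖_)
open import Function using (Bijective)

-- A hypergraph with vertex set Fin n, edge set Fin m and incidence
-- function inc : Fin m → Subset n, every edge having at least 2 vertices.
-- (Parallel edges are allowed: distinct edges may have equal incidence sets.)
record Hypergraph : Set where
  field
    n    : ℕ
    m    : ℕ
    inc  : Fin m → Subset n
    inc≥2 : ∀ e → 2 ≤ ∣ inc e ∣
open Hypergraph public

incident : (H : Hypergraph) → Fin (n H) → Subset (m H)
incident H v = tabulate (λ e → lookup (inc H e) v)

inducedEdges : (H : Hypergraph) → Subset (n H) → Subset (m H)
inducedEdges H X = tabulate (λ e → does (≡-dec _≟ᵇ_ (inc H e ∩ X) (inc H e)))

IsSubOf : (H : Hypergraph) → Subset (n H) → Subset (n H) → Subset (m H) → Set
IsSubOf H X Y F = Y ⊆ X × (∀ e → e ∈ F → e ∈ inducedEdges H X × inc H e ⊆ Y)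

degIn : (H : Hypergraph) → Subset (m H) → Fin (n H) → ℕ
degIn H F v = ∣ F ∩ incident H v ∣

deg : (H : Hypergraph) → Fin (n H) → ℕ
deg H v = ∣ incident H v ∣

-- maximum degree of H (0 if H has no vertices)
maxDeg : Hypergraph → ℕ
maxDeg H = Data.List.foldr Data.Nat._⊔_ 0 (map (deg H) (allFin (n H)))

MaxDegInducedLe : (H : Hypergraph) → Subset (n H) → ℕ → Set
MaxDegInducedLe H X k = ∀ v → v ∈ X → degIn H (inducedEdges H X) v ≤ k

StrictlyDegenerate : (H : Hypergraph) → Subset (n H) → ℕ → Set
StrictlyDegenerate H X k =
  ∀ (Y : Subset (n H)) (F : Subset (m H)) → IsSubOf H X Y F → Nonempty Y →
  ∃[ v ] (v ∈ Y × degIn H F v < k)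

-- col(H[X]) ≤ k, col being the least k' with H[X] strictly k'-degenerate
ColLe : (H : Hypergraph) → Subset (n H) → ℕ → Set
ColLe H X k = ∃[ k' ] (k' ≤ k × StrictlyDegenerate H X k')

Connected : Hypergraph → Set
Connected H =
  1 ≤ n H ×
  (∀ (X : Subset (n H)) → Nonempty X → (∃[ u ] u ∉ X) →
     ∃[ e ] ((∃[ u ] (u ∈ inc H e × u ∈ X)) × (∃[ w ] (w ∈ inc H e × w ∉ X))))

Ordinary : (H : Hypergraph) → Fin (m H) → Set
Ordinary H e = ∣ inc H e ∣ ≡ 2

mult : (H : Hypergraph) → Fin (n H) → Fin (n H) → ℕ
mult H u v = ∣ tabulate (λ e → does (≡-dec _≟ᵇ_ (inc H e) (⁅ u ⁆ ∪ ⁅ v ⁆))) ∣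

IsTK : Hypergraph → ℕ → ℕ → Set
IsTK H t N =
  n H ≡ N × (∀ e → Ordinary H e) × (∀ u v → u ≢ v → mult H u v ≡ t)

CycAdj : {N : ℕ} → Fin N → Fin N → Set
CycAdj {N} i j = toℕ j ≡ (toℕ i + 1) % suc (N Data.Nat.∸ 1)
               ⊎ toℕ i ≡ (toℕ j + 1) % suc (N Data.Nat.∸ 1)

IsTC : Hypergraph → ℕ → ℕ → Set
IsTC H t N =
  3 ≤ N × (∀ e → Ordinary H e) ×
  (Σ (Fin N → Fin (n H)) λ σ → Bijective _≡_ _≡_ σ ×
     (∀ i j → (CycAdj i j → mult H (σ i) (σ j) ≡ t)
            × (¬ CycAdj i j → mult H (σ i) (σ j) ≡ 0)))

Odd : ℕ → Set
Odd N = N % 2 ≡ 1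

sumFin : (p : ℕ) → (Fin p → ℕ) → ℕ
sumFin p k = sum (map k (allFin p))

part : {N p : ℕ} → (Fin N → Fin p) → Fin p → Subset N
part f i = tabulate (λ v → does (f v ≟ᶠ i))

{-# OPTIONS --safe #-}
module Submission where

-- Merging k₂, …, k_p reduces the existence of strictly kᵢ-degenerate classes to p = 2, because a
-- strictly (a + b)-degenerate hypergraph splits greedily.  The bounds on the maximum degree come
-- for free: moving a vertex with too many edges in its class i to a class j where it has fewer
-- than kⱼ keeps degeneracy and decreases Σᵢ (|E(Hᵢ)| − kᵢ |V(Hᵢ)|).
--
-- For two classes, suppose no partition exists.  Colour all vertices but one, the token x, keeping
-- the classes degenerate.  Then x has exactly kᵢ edges into class i and no other edges, and the
-- token may exchange places with any neighbour.  So these equalities survive every walk of the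
-- token, as on the board of the 15-puzzle.  If x is not a cut vertex, walks from x back to x
-- transpose the colours of any two neighbours of x; therefore all edges at x are ordinary and
-- all neighbours are joined to x with the same multiplicity.  If moreover x has at least three
-- neighbours, no two of them are joined by a path with inner vertices outside N[x].  Applied
-- to the non-cut vertices of an end block this yields tKₙ when some vertex has three neighbours
-- and an odd tCₙ otherwise, and regularity shows that the block is all of H.

open import Defs
open import Data.Nat
open import Data.Nat.Properties hiding (suc-injective)
open import Data.Nat.DivMod using (m<n⇒m%n≡m; n%n≡0)
open import Data.Nat.Induction using (<-wellFounded)
open import Data.Nat.ListAction using () renaming (sum to listSum)
open import Data.Nat.Solver using (module +-*-Solver)
open import Induction.WellFounded using (Acc; acc)
open import Data.Bool using (Bool; true; false; not; if_then_else_)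
open import Data.Bool.Properties using (¬-not; not-¬) renaming (_≟_ to _≟ᵇ_)
open import Data.Fin using (Fin; zero; suc; toℕ; fromℕ<)
open import Data.Fin.Properties
  using (any?; all?; suc-injective; pigeonhole; toℕ-fromℕ<; toℕ-injective; toℕ<n) renaming (_≟_ to _≟ᶠ_)
open import Data.Fin.Subset
  using (Subset; inside; outside; ∣_∣; _∈_; _∉_; _⊆_; _∩_; _∪_; ∁; ⊤; Nonempty; ⁅_⁆; _-_)
open import Data.Fin.Subset.Properties
open import Data.Vec using (_∷_; []; here; there; tabulate; lookup)
open import Data.Vec.Properties using (≡-dec; lookup∘tabulate; lookup⇒[]=; []=⇒lookup)
open import Data.List using (foldr; map)
open import Data.List.Properties using (map-tabulate)
open import Data.List.Membership.Propositional using () renaming (_∈_ to _∈ˡ_)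
open import Data.List.Membership.Propositional.Properties using (∈-allFin)
open import Data.List.Relation.Unary.Any using (here; there)
open import Data.Product using (Σ; ∃; ∃-syntax; _×_; _,_; proj₁; proj₂)
open import Data.Sum using (_⊎_; inj₁; inj₂)
open import Data.Empty using (⊥; ⊥-elim)
open import Function using (_∘_; id)
open import Relation.Nullary using (¬_; Dec; yes; no; does; contradiction; ¬?; _×-dec_; _→-dec_; _⊎-dec_)
open import Relation.Nullary.Decidable using (dec-true)
open import Relation.Unary using (Decidable)
open import Relation.Binary.Definitions using (tri<; tri≈; tri>)
open import Relation.Binary.Construct.Closure.ReflexiveTransitive using (Star; ε; _◅_; _◅◅_)
open import Relation.Binary.PropositionalEquality
open import Algebra.Properties.CommutativeMonoid.Sum +-0-commutativeMonoid
  using (sum; sum-cong-≗; ∑-distrib-+; ∑-comm)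
open import Algebra.Properties.Semiring.Sum +-*-semiring using (*-distribˡ-sum)

-- Finite sums and counting

sum-mono : ∀ {k} {f g : Fin k → ℕ} → (∀ i → f i ≤ g i) → sum f ≤ sum g
sum-mono {zero} f≤g = z≤n
sum-mono {suc k} f≤g = +-mono-≤ (f≤g zero) (sum-mono (λ i → f≤g (suc i)))

sum-mono-< : ∀ {k} {f g : Fin k → ℕ} → (∀ i → f i ≤ g i) → ∀ i → f i < g i → sum f < sum g
sum-mono-< f≤g zero lt = +-mono-<-≤ lt (sum-mono (λ i → f≤g (suc i)))
sum-mono-< f≤g (suc i) lt = +-mono-≤-< (f≤g zero) (sum-mono-< (λ j → f≤g (suc j)) i lt)

-- The old term is added on one side and the new one on the other, because subtraction on ℕ
-- truncates.
sum-exchange : ∀ {k} {f g : Fin k → ℕ} i → (∀ j → j ≢ i → f j ≡ g j) →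
  sum f + g i ≡ sum g + f i
sum-exchange {suc k} {f} {g} zero eq
  rewrite sum-cong-≗ {k} {λ i → f (suc i)} {λ i → g (suc i)} (λ j → eq (suc j) λ ())
        | +-comm (f zero) (sum (λ i → g (suc i)))
        | +-assoc (sum (λ i → g (suc i))) (f zero) (g zero)
        | +-comm (f zero) (g zero)
        | sym (+-assoc (sum (λ i → g (suc i))) (g zero) (f zero))
        | +-comm (sum (λ i → g (suc i))) (g zero) = refl
sum-exchange {suc k} {f} {g} (suc i) eq
  rewrite eq zero (λ ())
        | +-assoc (g zero) (sum (λ i → f (suc i))) (g (suc i))
        | sum-exchange {k} {λ i → f (suc i)} {λ i → g (suc i)} i (λ j ne → eq (suc j) λ e → ne (suc-injective e))
  = sym (+-assoc (g zero) (sum (λ i → g (suc i))) (f (suc i)))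

ind : {A : Set} → Dec A → ℕ
ind (yes _) = 1
ind (no _) = 0

infix 9 #_
-- Cardinality as a sum of indicators: double sums can be exchanged, and no `Subset` has to be built
-- for each predicate.
#_ : ∀ {k} {P : Fin k → Set} → Decidable P → ℕ
# P? = sum (λ i → ind (P? i))

private
  ind-mono : ∀ {A B : Set} (a : Dec A) (b : Dec B) → (A → B) → ind a ≤ ind b
  ind-mono (no _) b f = z≤n
  ind-mono (yes a) (yes b) f = ≤-refl
  ind-mono (yes a) (no ¬b) f = contradiction (f a) ¬b

  ind-disjoint : ∀ {A B C : Set} (a : Dec A) (b : Dec B) (c : Dec C) →
    (A → C) → (B → C) → (A → B → ⊥) → ind a + ind b ≤ ind c
  ind-disjoint (no _) b c f g h = ind-mono b c g
  ind-disjoint (yes a) (no _) c f g h = ind-mono (yes a) c f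
  ind-disjoint (yes a) (yes b) c f g h = ⊥-elim (h a b)

  ind-yes : ∀ {A : Set} (a : Dec A) → A → ind a ≡ 1
  ind-yes (yes _) _ = refl
  ind-yes (no ¬a) a = contradiction a ¬a

  ind-no : ∀ {A : Set} (a : Dec A) → ¬ A → ind a ≡ 0
  ind-no (no _) _ = refl
  ind-no (yes a) ¬a = contradiction a ¬a

#-mono : ∀ {k} {P Q : Fin k → Set} (P? : Decidable P) (Q? : Decidable Q) →
  (∀ i → P i → Q i) → # P? ≤ # Q?
#-mono P? Q? f = sum-mono (λ i → ind-mono (P? i) (Q? i) (f i))

#-cong : ∀ {k} {P Q : Fin k → Set} (P? : Decidable P) (Q? : Decidable Q) →
  (∀ i → P i → Q i) → (∀ i → Q i → P i) → # P? ≡ # Q?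
#-cong P? Q? f g = ≤-antisym (#-mono P? Q? f) (#-mono Q? P? g)

#-mono-< : ∀ {k} {P Q : Fin k → Set} (P? : Decidable P) (Q? : Decidable Q) →
  (∀ i → P i → Q i) → ∀ i → Q i → ¬ P i → # P? < # Q?
#-mono-< P? Q? f i q ¬p = sum-mono-< (λ j → ind-mono (P? j) (Q? j) (f j)) i
  (subst₂ _<_ (sym (ind-no (P? i) ¬p)) (sym (ind-yes (Q? i) q)) (s≤s z≤n))

module _ {k} {P Q R : Fin k → Set} (P? : Decidable P) (Q? : Decidable Q) (R? : Decidable R) where
  private
    eq : # P? + # Q? ≡ sum (λ i → ind (P? i) + ind (Q? i))
    eq = sym (∑-distrib-+ (λ i → ind (P? i)) (λ i → ind (Q? i)))

  #-disjoint : (∀ i → P i → R i) → (∀ i → Q i → R i) → (∀ i → P i → Q i → ⊥) →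
    # P? + # Q? ≤ # R?
  #-disjoint f g h = ≤-trans (≤-reflexive eq)
    (sum-mono (λ i → ind-disjoint (P? i) (Q? i) (R? i) (f i) (g i) (h i)))

  #-disjoint-< : (∀ i → P i → R i) → (∀ i → Q i → R i) → (∀ i → P i → Q i → ⊥) →
    ∀ i → R i → ¬ P i → ¬ Q i → # P? + # Q? < # R?
  #-disjoint-< f g h i r ¬p ¬q = ≤-<-trans (≤-reflexive eq)
    (sum-mono-< (λ j → ind-disjoint (P? j) (Q? j) (R? j) (f j) (g j) (h j)) i
      (subst₂ _<_ (sym (cong₂ _+_ (ind-no (P? i) ¬p) (ind-no (Q? i) ¬q)))
        (sym (ind-yes (R? i) r)) (s≤s z≤n)))

  #-cover : (∀ i → R i → P i ⊎ Q i) → # R? ≤ # P? + # Q?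
  #-cover f = ≤-trans (sum-mono (λ i → go (P? i) (Q? i) (R? i) (f i))) (≤-reflexive (sym eq))
    where
    go : ∀ {A B C : Set} (a : Dec A) (b : Dec B) (c : Dec C) → (C → A ⊎ B) → ind c ≤ ind a + ind b
    go a b (no _) f = z≤n
    go (yes _) b (yes c) f = s≤s z≤n
    go (no _) (yes _) (yes c) f = s≤s z≤n
    go (no ¬a) (no ¬b) (yes c) f with f c
    ... | inj₁ a = contradiction a ¬a
    ... | inj₂ b = contradiction b ¬b

  #-split : (∀ i → P i → R i) → (∀ i → Q i → R i) → (∀ i → P i → Q i → ⊥) →
    (∀ i → R i → P i ⊎ Q i) → # R? ≡ # P? + # Q?
  #-split f g h c = ≤-antisym (#-cover c) (#-disjoint f g h)

#-none : ∀ {k} {P : Fin k → Set} (P? : Decidable P) → (∀ i → ¬ P i) → # P? ≡ 0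
#-none {zero} P? none = refl
#-none {suc k} P? none = cong₂ _+_ (ind-no (P? zero) (none zero)) (#-none (λ i → P? (suc i)) (λ i → none (suc i)))

#-exists : ∀ {k} {P : Fin k → Set} (P? : Decidable P) → 1 ≤ # P? → ∃ P
#-exists P? le with any? P?
... | yes p = p
... | no none = contradiction (subst (1 ≤_) (#-none P? (λ i p → none (i , p))) le) λ ()

#-positive : ∀ {k} {P : Fin k → Set} (P? : Decidable P) → ∃ P → 1 ≤ # P?
#-positive P? (i , p) = ≤-<-trans z≤n (#-mono-< {P = λ _ → ⊥} (λ _ → no λ ()) P? (λ _ ()) i p λ ())

#-single : ∀ {k} (i : Fin k) → # (_≟ᶠ i) ≡ 1
#-single {suc k} zero = cong suc (#-none {k} (λ j → suc j ≟ᶠ zero) (λ j ()))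
#-single {suc k} (suc i) = trans (#-cong {k} (λ j → suc j ≟ᶠ suc i) (_≟ᶠ i) (λ j → suc-injective) (λ j → cong suc)) (#-single i)

#-unique : ∀ {k} {P : Fin k → Set} (P? : Decidable P) i → P i → (∀ j → P j → j ≡ i) → # P? ≡ 1
#-unique P? i p uniq = trans (#-cong P? (_≟ᶠ i) uniq (λ { j refl → p })) (#-single i)

∣∣≡# : ∀ {k} (S : Subset k) → ∣ S ∣ ≡ # (_∈? S)
∣∣≡# [] = refl
∣∣≡# (inside ∷ S) = cong suc (trans (∣∣≡# S)
  (#-cong (_∈? S) (λ i → suc i ∈? (inside ∷ S)) (λ i → there) (λ i → drop-there)))
∣∣≡# (outside ∷ S) = trans (∣∣≡# S)
  (#-cong (_∈? S) (λ i → suc i ∈? (outside ∷ S)) (λ i → there) (λ i → drop-there))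

-- Each `e` in `F` is related to exactly one `v`, so both sides count the pairs of `R`, once by
-- columns and once by rows.
double-count : ∀ {k l} {F : Fin k → Set} {D : Fin l → Set} {R : Fin l → Fin k → Set}
  (F? : Decidable F) (D? : Decidable D) (R? : ∀ v → Decidable (R v)) (t : ℕ) →
  (∀ v → D v → # (R? v) ≡ t) → (∀ {v e} → R v e → D v) → (∀ {v e} → R v e → F e) →
  (∀ {v w e} → R v e → R w e → v ≡ w) → (∀ {e} → F e → ∃[ v ] R v e) →
  # F? ≡ t * # D?
double-count {F = F} {D} {R} F? D? R? t deg R⇒D R⇒F uniq ex = begin
  sum (λ e → ind (F? e))                     ≡⟨ sum-cong-≗ one ⟩
  sum (λ e → sum (λ v → ind (R? v e)))       ≡⟨ ∑-comm (λ e v → ind (R? v e)) ⟩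
  sum (λ v → # (R? v))                       ≡⟨ sum-cong-≗ row ⟩
  sum (λ v → t * ind (D? v))                 ≡⟨ *-distribˡ-sum t (λ v → ind (D? v)) ⟨
  t * # D?                                   ∎
  where
  open ≡-Reasoning
  one : ∀ e → ind (F? e) ≡ # (λ v → R? v e)
  one e with F? e
  ... | no ¬f = sym (#-none (λ v → R? v e) (λ v r → ¬f (R⇒F r)))
  ... | yes f = let v , r = ex f in sym (#-unique (λ v → R? v e) v r (λ w r' → uniq r' r))
  row : ∀ v → # (R? v) ≡ t * ind (D? v)
  row v with D? v
  ... | yes d = trans (deg v d) (sym (*-identityʳ t))
  ... | no ¬d = trans (#-none (R? v) (λ e r → ¬d (R⇒D r))) (sym (*-zeroʳ t))

-- Pointwise updates, decidable subsets and Boolean colours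

upd : ∀ {k} {A : Set} → (Fin k → A) → Fin k → A → Fin k → A
upd f v c u = if does (u ≟ᶠ v) then c else f u

upd-eq : ∀ {k} {A : Set} (f : Fin k → A) v c → upd f v c v ≡ c
upd-eq f v c with v ≟ᶠ v
... | yes _ = refl
... | no ne = contradiction refl ne

upd-neq : ∀ {k} {A : Set} (f : Fin k → A) v c {u} → u ≢ v → upd f v c u ≡ f u
upd-neq f v c {u} ne with u ≟ᶠ v
... | yes eq = contradiction eq ne
... | no _ = refl

⟦_⟧ : ∀ {k} {P : Fin k → Set} → Decidable P → Subset k
⟦ P? ⟧ = tabulate (λ i → does (P? i))

∈⟦⟧⁺ : ∀ {k} {P : Fin k → Set} (P? : Decidable P) {i} → P i → i ∈ ⟦ P? ⟧
∈⟦⟧⁺ P? {i} p = lookup⇒[]= i ⟦ P? ⟧ (trans (lookup∘tabulate (λ i → does (P? i)) i) (dec-true (P? i) p))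

∈⟦⟧⁻ : ∀ {k} {P : Fin k → Set} (P? : Decidable P) {i} → i ∈ ⟦ P? ⟧ → P i
∈⟦⟧⁻ P? {i} i∈ with P? i | trans (sym (lookup∘tabulate (λ i → does (P? i)) i)) ([]=⇒lookup i∈)
... | yes p | _ = p
... | no _ | ()

double-not : ∀ b → not (not b) ≡ b
double-not true = refl
double-not false = refl

other-colour : ∀ {b c d : Bool} → b ≢ c → d ≢ c → b ≡ d
other-colour b≢c d≢c = trans (¬-not b≢c) (sym (¬-not d≢c))

split-off : ∀ {k} (X : Subset k) {v} u → u ∈ X → u ∈ (X - v) ⊎ u ≡ v
split-off X {v} u u∈X with u ≟ᶠ v
... | yes u≡v = inj₂ u≡v
... | no u≢v = inj₁ (x∈p∧x≢y⇒x∈p-y u∈X u≢v)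

-- Degeneracy, greedy splitting and the degree bound

module Hyper (H : Hypergraph) where

  V E : Set
  V = Fin (n H)
  E = Fin (m H)

  -- The edges at `v` in the subhypergraph induced by `X` together with `v`. As `v` may lie outside
  -- `X`, this covers degrees inside a class as well as edges from the token into a class.
  Near : (V → Set) → V → E → Set
  Near X v e = v ∈ inc H e × (∀ u → u ∈ inc H e → u ≢ v → X u)

  near? : ∀ {X : V → Set} → Decidable X → ∀ v → Decidable (Near X v)
  near? X? v e = (v ∈? inc H e) ×-dec all? (λ u → (u ∈? inc H e) →-dec (¬? (u ≟ᶠ v) →-dec X? u))

  Near-mono : ∀ {X X' : V → Set} {v e} → (∀ u → u ≢ v → X u → X' u) → Near X v e → Near X' v e
  Near-mono f (v∈e , near) = v∈e , λ u u∈e u≢v → f u u≢v (near u u∈e u≢v)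

  other : ∀ {v e} → v ∈ inc H e → ∃[ u ] (u ∈ inc H e × u ≢ v)
  other {v} {e} v∈e with any? (λ u → (u ∈? inc H e) ×-dec ¬? (u ≟ᶠ v))
  ... | yes found = found
  ... | no none = contradiction (inc≥2 H e) (<⇒≱ (s≤s (≤-trans (p⊆q⇒∣p∣≤∣q∣ sub) (≤-reflexive (∣⁅x⁆∣≡1 v)))))
    where
    sub : inc H e ⊆ ⁅ v ⁆
    sub {u} u∈e with u ≟ᶠ v
    ... | yes refl = x∈⁅x⁆ v
    ... | no u≢v = contradiction (u , u∈e , u≢v) none

  -- Only induced subhypergraphs are tested: deleting further edges lowers degrees, so the vertex
  -- found serves every subhypergraph on `Y`.
  Degenerate : (V → Set) → ℕ → Set
  Degenerate X k = ∀ (Y : Subset (n H)) → (∀ v → v ∈ Y → X v) → Nonempty Y →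
    ∃[ v ] (v ∈ Y × # (near? (_∈? Y) v) < k)

  degenerate-⊆ : ∀ {X X' : V → Set} {k} → (∀ v → X' v → X v) → Degenerate X k → Degenerate X' k
  degenerate-⊆ sub D Y Y⊆X' = D Y (λ v v∈Y → sub v (Y⊆X' v v∈Y))

  -- A set `Y` through `v` has `v` itself as its vertex of small degree; any other `Y` already lies
  -- in `X`.
  degenerate-insert : ∀ {X X' : V → Set} {k} (X? : Decidable X) v → (∀ u → X' u → X u ⊎ u ≡ v) →
    Degenerate X k → # (near? X? v) < k → Degenerate X' k
  degenerate-insert {X} {X'} X? v split D small Y Y⊆X' Y≠∅ with v ∈? Y
  ... | yes v∈Y = v , v∈Y , ≤-<-trans (#-mono (near? (_∈? Y) v) (near? X? v) λ e → Near-mono keep) small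
    where
    keep : ∀ u → u ≢ v → u ∈ Y → X u
    keep u u≢v u∈Y with split u (Y⊆X' u u∈Y)
    ... | inj₁ x = x
    ... | inj₂ u≡v = contradiction u≡v u≢v
  ... | no v∉Y = D Y keep Y≠∅
    where
    keep : ∀ u → u ∈ Y → X u
    keep u u∈Y with split u (Y⊆X' u u∈Y)
    ... | inj₁ x = x
    ... | inj₂ refl = contradiction u∈Y v∉Y

  Class : (V → Set) → (V → Bool) → Bool → V → Set
  Class X f c v = X v × f v ≡ c

  class? : ∀ {X : V → Set} → Decidable X → ∀ f c → Decidable (Class X f c)
  class? X? f c v = X? v ×-dec (f v ≟ᵇ c)

  -- An edge has a second vertex besides `v`, and that vertex has only one colour.
  classes-disjoint : ∀ {X f v e} → Near (Class X f true) v e → Near (Class X f false) v e → ⊥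
  classes-disjoint (v∈e , t) (_ , f) with other v∈e
  ... | u , u∈e , u≢v with trans (sym (proj₂ (t u u∈e u≢v))) (proj₂ (f u u∈e u≢v))
  ... | ()

  class-degrees : ∀ {X : V → Set} (X? : Decidable X) f v →
    # (near? (class? X? f true) v) + # (near? (class? X? f false) v) ≤ # (near? X? v)
  class-degrees X? f v = #-disjoint (near? (class? X? f true) v) (near? (class? X? f false) v) (near? X? v)
    (λ e → Near-mono (λ u _ → proj₁)) (λ e → Near-mono (λ u _ → proj₁)) (λ e → classes-disjoint)

  module Split (κ : Bool → ℕ) where

    Partition : (V → Set) → (V → Bool) → Set
    Partition X f = ∀ c → Degenerate (Class X f c) (κ c)

    -- Class `c` gains at most `v`, where its degree is small, and the other class gains nothing.
    -- This one step serves to colour a new vertex, to move a vertex to the other class and to move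
    -- the token.
    partition-recolour : ∀ {X X' : V → Set} {f} (X? : Decidable X) v c → (∀ u → X' u → X u ⊎ u ≡ v) →
      Partition X f → # (near? (class? X? f c) v) < κ c → Partition X' (upd f v c)
    partition-recolour {X} {X'} {f} X? v c split P small d with d ≟ᵇ c
    ... | yes refl = degenerate-insert (class? X? f c) v keep (P c) small
      where
      keep : ∀ u → Class X' (upd f v c) c u → Class X f c u ⊎ u ≡ v
      keep u (x' , eq) with u ≟ᶠ v
      ... | yes u≡v = inj₂ u≡v
      ... | no u≢v with split u x'
      ... | inj₁ x = inj₁ (x , eq)
      ... | inj₂ u≡v = inj₂ u≡v
    ... | no d≢c = degenerate-⊆ keep (P d)
      where
      keep : ∀ u → Class X' (upd f v c) d u → Class X f d u
      keep u (x' , eq) with u ≟ᶠ v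
      ... | yes u≡v = contradiction (sym eq) d≢c
      ... | no u≢v with split u x'
      ... | inj₁ x = x , eq
      ... | inj₂ u≡v = contradiction u≡v u≢v

    -- If both classes were full for `v`, their edges at `v` would already number
    -- `κ true + κ false`.
    partition-insert : ∀ {X X' : V → Set} {f} (X? : Decidable X) v → (∀ u → X' u → X u ⊎ u ≡ v) →
      Partition X f → # (near? X? v) < κ true + κ false → ∃[ f' ] Partition X' f'
    partition-insert {f = f} X? v split P small with # (near? (class? X? f true) v) <? κ true
    ... | yes lt = _ , partition-recolour X? v true split P lt
    ... | no ≥t with # (near? (class? X? f false) v) <? κ false
    ... | yes lf = _ , partition-recolour X? v false split P lf
    ... | no ≥f = contradiction (≤-trans (+-mono-≤ (≮⇒≥ ≥t) (≮⇒≥ ≥f)) (class-degrees X? f v)) (<⇒≱ small)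

    -- Greedy: remove a vertex of degree below `κ true + κ false`, split the rest, and put the
    -- vertex back.
    split-degenerate : ∀ (X : Subset (n H)) → Degenerate (_∈ X) (κ true + κ false) → ∃[ f ] Partition (_∈ X) f
    split-degenerate X = go X (<-wellFounded ∣ X ∣)
      where
      go : ∀ (X : Subset (n H)) → Acc _<_ ∣ X ∣ → Degenerate (_∈ X) (κ true + κ false) → ∃[ f ] Partition (_∈ X) f
      go X (acc rec) D with nonempty? X
      ... | no empty = (λ _ → true) , λ c Y Y⊆X → λ { (v , v∈Y) → contradiction (v , proj₁ (Y⊆X v v∈Y)) empty }
      ... | yes X≠∅ with D X (λ _ → id) X≠∅
      ... | v , v∈X , small with go (X - v) (rec (x∈p⇒∣p-x∣<∣p∣ v∈X)) (degenerate-⊆ (λ _ → p─q⊆p X ⁅ v ⁆) D)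
      ... | f , P = partition-insert (_∈? (X - v)) v (split-off X) P
          (≤-<-trans (#-mono (near? (_∈? (X - v)) v) (near? (_∈? X) v) (λ e → Near-mono λ u _ → p─q⊆p X ⁅ v ⁆)) small)

    module _ (X : Subset (n H)) where
      private
        classDeg : (V → Bool) → Bool → V → ℕ
        classDeg f c v = # (near? (class? (_∈? X) f c) v)

        Mono : (V → Bool) → E → Set
        Mono f e = inc H e ⊆ X × (∀ u w → u ∈ inc H e → w ∈ inc H e → f u ≡ f w)

        mono? : ∀ f → Decidable (Mono f)
        mono? f e = (inc H e ⊆? X) ×-dec all? (λ u → all? (λ w → (u ∈? inc H e) →-dec ((w ∈? inc H e) →-dec (f u ≟ᵇ f w))))

        MonoOff : V → (V → Bool) → E → Set
        MonoOff v f e = Mono f e × v ∉ inc H e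

        monoOff? : ∀ v f → Decidable (MonoOff v f)
        monoOff? v f e = mono? f e ×-dec ¬? (v ∈? inc H e)

        -- This is `κ true + κ false` minus `κ (f v)`; up to a constant, the term -Σᵢ kᵢ |V(Hᵢ)| is
        -- thus expressed without subtraction.
        weight : (V → Bool) → V → ℕ
        weight f v = κ (not (f v))

        -- Recolouring v from c to d changes this by (deg_d v - κ d) - (deg_c v - κ c).
        potential : (V → Bool) → ℕ
        potential f = # (mono? f) + sum (weight f)

        -- Recolouring `v` leaves the first summand unchanged, so the edge count changes exactly as
        -- the degree of `v` in its own class.
        mono-split : ∀ {v} → v ∈ X → ∀ f → # (mono? f) ≡ # (monoOff? v f) + classDeg f (f v) v
        mono-split {v} v∈X f = #-split (monoOff? v f) (near? (class? (_∈? X) f (f v)) v) (mono? f)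
          (λ e → proj₁) back (λ { e (_ , v∉e) (v∈e , _) → v∉e v∈e }) cover
          where
          back : ∀ e → Near (Class (_∈ X) f (f v)) v e → Mono f e
          back e (v∈e , near) = (λ {u} → inX u) , λ u w u∈e w∈e → trans (same u u∈e) (sym (same w w∈e))
            where
            inX : ∀ u → u ∈ inc H e → u ∈ X
            inX u u∈e with u ≟ᶠ v
            ... | yes refl = v∈X
            ... | no ne = proj₁ (near u u∈e ne)
            same : ∀ u → u ∈ inc H e → f u ≡ f v
            same u u∈e with u ≟ᶠ v
            ... | yes refl = refl
            ... | no ne = proj₂ (near u u∈e ne)
          cover : ∀ e → Mono f e → MonoOff v f e ⊎ Near (Class (_∈ X) f (f v)) v e
          cover e (sub , mono) with v ∈? inc H e
          ... | yes v∈e = inj₂ (v∈e , λ u u∈e _ → sub u∈e , mono u v u∈e v∈e)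
          ... | no v∉e = inj₁ ((sub , mono) , v∉e)

        potential-drops : ∀ {v} → v ∈ X → ∀ f → κ (f v) < classDeg f (f v) v →
          classDeg f (not (f v)) v < κ (not (f v)) → potential (upd f v (not (f v))) < potential f
        -- `K` is the old weight of `v`; adding it to both sides lets `sum-exchange` trade the new
        -- sum of weights for the old one.
        potential-drops {v} v∈X f big small = +-cancelʳ-< K (potential f') (potential f) (begin-strict
          # (mono? f') + sum (weight f') + K
            ≡⟨ cong (λ z → z + sum (weight f') + K) (mono-split v∈X f') ⟩
          # (monoOff? v f') + classDeg f' (f' v) v + sum (weight f') + K
            ≡⟨ cong₂ (λ y z → y + z + sum (weight f') + K) off-eq deg-eq ⟩
          o + d' + sum (weight f') + K
            ≡⟨ +-assoc (o + d') _ _ ⟩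
          o + d' + (sum (weight f') + K)
            ≡⟨ cong (o + d' +_) (sum-exchange {f = weight f'} {g = weight f} v (λ j ne → cong (κ ∘ not) (upd-neq f v _ ne))) ⟩
          o + d' + (sum (weight f) + weight f' v)
            ≡⟨ cong (λ z → o + d' + (sum (weight f) + κ z)) (trans (cong not (upd-eq f v _)) (double-not (f v))) ⟩
          o + d' + (sum (weight f) + κ (f v))
            <⟨ arith o (sum (weight f)) small big ⟩
          o + d + sum (weight f) + K
            ≡⟨ cong (λ z → z + sum (weight f) + K) (mono-split v∈X f) ⟨
          # (mono? f) + sum (weight f) + K ∎)
          where
          open ≤-Reasoning
          f' = upd f v (not (f v))
          K = κ (not (f v))
          d = classDeg f (f v) v
          d' = classDeg f (not (f v)) v
          o = # (monoOff? v f)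
          deg-eq : classDeg f' (f' v) v ≡ d'
          deg-eq rewrite upd-eq f v (not (f v)) = #-cong (near? (class? (_∈? X) f' (not (f v))) v) (near? (class? (_∈? X) f (not (f v))) v)
            (λ e → Near-mono λ { u ne (x , eq) → x , trans (sym (upd-neq f v _ ne)) eq })
            (λ e → Near-mono λ { u ne (x , eq) → x , trans (upd-neq f v _ ne) eq })
          off : ∀ {g h : V → Bool} → (∀ u → u ≢ v → g u ≡ h u) → ∀ e → MonoOff v h e → MonoOff v g e
          off eq e ((sub , mono) , v∉e) = (sub , λ u w u∈e w∈e →
            trans (eq u (λ { refl → v∉e u∈e })) (trans (mono u w u∈e w∈e) (sym (eq w (λ { refl → v∉e w∈e }))))) , v∉e
          off-eq : # (monoOff? v f') ≡ o
          off-eq = #-cong (monoOff? v f') (monoOff? v f) (off (λ u ne → sym (upd-neq f v _ ne))) (off (λ u ne → upd-neq f v _ ne))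
          arith : ∀ o s → d' < K → κ (f v) < d → o + d' + (s + κ (f v)) < o + d + s + K
          arith o s p q = subst₂ _<_
            (trans (cong (_+ (o + s)) (+-comm d' (κ (f v)))) (shuffle o s (κ (f v)) d'))
            (trans (cong (_+ (o + s)) (+-comm K d)) (trans (shuffle o s d K) (shuffle' o s d K)))
            (+-monoˡ-< (o + s) (+-mono-< p q))
            where
            open +-*-Solver
            shuffle : ∀ o s x y → x + y + (o + s) ≡ o + y + (s + x)
            shuffle = solve 4 (λ o s x y → x :+ y :+ (o :+ s) := o :+ y :+ (s :+ x)) refl
            shuffle' : ∀ o s x y → o + y + (s + x) ≡ o + x + s + y
            shuffle' = solve 4 (λ o s x y → o :+ y :+ (s :+ x) := o :+ x :+ s :+ y) refl

      -- A vertex with more than `κ (f v)` edges in its own class has room in the other one, as its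
      -- degree is at most `κ true + κ false`. Moving it keeps the partition and lowers the
      -- potential.
      improve : (∀ v → v ∈ X → # (near? (_∈? X) v) ≤ κ true + κ false) → ∀ f → Partition (_∈ X) f →
        ∃[ g ] (Partition (_∈ X) g × (∀ v → v ∈ X → # (near? (class? (_∈? X) g (g v)) v) ≤ κ (g v)))
      improve Δ f = go f (<-wellFounded (potential f))
        where
        go : ∀ f → Acc _<_ (potential f) → Partition (_∈ X) f →
          ∃[ g ] (Partition (_∈ X) g × (∀ v → v ∈ X → classDeg g (g v) v ≤ κ (g v)))
        go f (acc rec) P with any? (λ v → (v ∈? X) ×-dec (κ (f v) <? classDeg f (f v) v))
        ... | no none = f , P , λ v v∈X → ≮⇒≥ (λ lt → none (v , v∈X , lt))
        ... | yes (v , v∈X , big) = go (upd f v c') (rec (potential-drops v∈X f big small))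
            (partition-recolour (_∈? (X - v)) v c' (split-off X) (λ c → degenerate-⊆ (λ { u (u∈ , eq) → p─q⊆p X ⁅ v ⁆ u∈ , eq }) (P c))
              (≤-<-trans (#-mono (near? (class? (_∈? (X - v)) f c') v) (near? (class? (_∈? X) f c') v)
                (λ e → Near-mono λ { u _ (u∈ , eq) → p─q⊆p X ⁅ v ⁆ u∈ , eq })) small))
          where
          c' = not (f v)
          both : ∀ c → κ c + κ (not c) ≡ κ true + κ false
          both true = refl
          both false = +-comm (κ false) (κ true)
          degs : ∀ c → classDeg f c v + classDeg f (not c) v ≤ # (near? (_∈? X) v)
          degs true = class-degrees (_∈? X) f v
          degs false = ≤-trans (≤-reflexive (+-comm (classDeg f false v) _)) (class-degrees (_∈? X) f v)
          small : classDeg f c' v < κ c'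
          small = +-cancelˡ-< (κ (f v)) _ _ (begin-strict
            κ (f v) + classDeg f c' v             <⟨ +-monoˡ-< _ big ⟩
            classDeg f (f v) v + classDeg f c' v  ≤⟨ degs (f v) ⟩
            # (near? (_∈? X) v)                   ≤⟨ Δ v v∈X ⟩
            κ true + κ false                      ≡⟨ both (f v) ⟨
            κ (f v) + κ c'                        ∎)
            where open ≤-Reasoning

-- From two classes to p parts

sumFin-suc : ∀ p (k : Fin (suc p) → ℕ) → sumFin (suc p) k ≡ k zero + sumFin p (k ∘ suc)
sumFin-suc p k = cong (λ l → k zero + listSum l)
  (trans (map-tabulate suc k) (sym (map-tabulate id (k ∘ suc))))

module Parts (H : Hypergraph) where
  open Hyper H

  -- A count refers to a decision procedure; quantifying over all of them makes the bound depend on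
  -- the set alone.
  Bounded : (V → Set) → ℕ → Set
  Bounded X k = Degenerate X k × (∀ (X? : Decidable X) v → X v → # (near? X? v) ≤ k)

  bounded-⊆ : ∀ {X X' : V → Set} {k} → Decidable X → (∀ v → X' v → X v) → Bounded X k → Bounded X' k
  bounded-⊆ X? sub (D , Δ) = degenerate-⊆ sub D , λ X'? v x' →
    ≤-trans (#-mono (near? X'? v) (near? X? v) (λ e → Near-mono (λ u _ → sub u))) (Δ X? v (sub v x'))

  sizes : ℕ → ℕ → Bool → ℕ
  sizes a b true = a
  sizes a b false = b

  class-bounded : ∀ a b X f → let open Split (sizes a b) in Partition (_∈ X) f →
    (∀ v → v ∈ X → # (near? (class? (_∈? X) f (f v)) v) ≤ sizes a b (f v)) →
    ∀ c → Bounded (Class (_∈ X) f c) (sizes a b c)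
  class-bounded a b X f P Δ c = P c , λ { X? v (v∈X , refl) →
    ≤-trans (#-mono (near? X? v) (near? (class? (_∈? X) f (f v)) v) (λ e → Near-mono λ _ _ → id)) (Δ v v∈X) }

  Parts : ∀ {p} → Subset (n H) → (Fin p → ℕ) → Set
  Parts {p} X k = Σ (V → Fin p) λ f → ∀ i → Bounded (λ v → v ∈ X × f v ≡ i) (k i)

  mutual
    -- Kept apart from `parts` because the first splitting of `H` comes from the token argument: `H`
    -- itself may fail to be degenerate, while its two classes are, and these split greedily.
    refine : ∀ p (k : Fin (suc (suc p)) → ℕ) X f →
      (∀ c → Bounded (Class (_∈ X) f c) (sizes (k zero) (sumFin (suc p) (k ∘ suc)) c)) → Parts X k
    refine p k X f B with parts p (k ∘ suc) Z (bounded-⊆ Z? (λ v → ∈⟦⟧⁻ Z?) (B false))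
      where
      Z? = class? (_∈? X) f false
      Z = ⟦ Z? ⟧
    ... | g , G = h , bound
      where
      Z? = class? (_∈? X) f false
      h : V → Fin (suc (suc p))
      h v = if f v then zero else suc (g v)
      bound : ∀ i → Bounded (λ v → v ∈ X × h v ≡ i) (k i)
      bound zero = bounded-⊆ (class? (_∈? X) f true) sub (B true)
        where
        sub : ∀ v → v ∈ X × h v ≡ zero → Class (_∈ X) f true v
        sub v (v∈X , eq) with f v
        ... | true = v∈X , refl
        sub v (v∈X , ()) | false
      bound (suc i) = bounded-⊆ (λ v → (v ∈? ⟦ Z? ⟧) ×-dec (g v ≟ᶠ i)) sub (G i)
        where
        sub : ∀ v → v ∈ X × h v ≡ suc i → v ∈ ⟦ Z? ⟧ × g v ≡ i
        sub v (v∈X , eq) with f v in fv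
        sub v (v∈X , ()) | true
        ... | false = ∈⟦⟧⁺ Z? (v∈X , fv) , suc-injective eq

    parts : ∀ p (k : Fin (suc p) → ℕ) X → Bounded (_∈ X) (sumFin (suc p) k) → Parts X k
    parts zero k X B = (λ _ → zero) , λ { zero →
      bounded-⊆ (_∈? X) (λ _ → proj₁) (subst (Bounded (_∈ X)) (+-identityʳ (k zero)) B) }
    parts (suc p) k X B =
      let D , Δ = subst (Bounded (_∈ X)) (sumFin-suc (suc p) k) B
          f , P = split-degenerate X D
          g , Q , Δg = improve X (Δ (_∈? X)) f P
      in refine p k X g (class-bounded _ _ X g Q Δg)
      where open Split (sizes (k zero) (sumFin (suc p) (k ∘ suc)))

  ∈-inducedEdges : ∀ {X e} → e ∈ inducedEdges H X → inc H e ⊆ X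
  ∈-inducedEdges {X} {e} e∈ {v} v∈e =
    proj₂ (x∈p∩q⁻ (inc H e) X (subst (v ∈_) (sym (∈⟦⟧⁻ (λ e → ≡-dec _≟ᵇ_ (inc H e ∩ X) (inc H e)) e∈)) v∈e))

  ∈-incident : ∀ {v e} → e ∈ incident H v → v ∈ inc H e
  ∈-incident {v} {e} e∈ = lookup⇒[]= v (inc H e) (trans (sym (lookup∘tabulate (λ e → lookup (inc H e) v) e)) ([]=⇒lookup e∈))

  degIn-≤ : ∀ {X : V → Set} (X? : Decidable X) {F} v → (∀ e → e ∈ F → ∀ {u} → u ∈ inc H e → X u) →
    degIn H F v ≤ # (near? X? v)
  degIn-≤ X? {F} v sub = ≤-trans (≤-reflexive (∣∣≡# (F ∩ incident H v)))
    (#-mono (_∈? (F ∩ incident H v)) (near? X? v) λ e e∈ →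
      let e∈F , e∈v = x∈p∩q⁻ F (incident H v) e∈ in ∈-incident e∈v , λ u u∈e _ → sub e e∈F u∈e)

  -- An arbitrary edge set `F` on `Y` gives degrees at most those of the subhypergraph induced by
  -- `Y`, where `Degenerate` supplies the vertex.
  bounded⇒ : ∀ {p} (f : V → Fin p) i k → Bounded (λ v → f v ≡ i) k →
    ColLe H (part f i) k × MaxDegInducedLe H (part f i) k
  bounded⇒ f i k (D , Δ) = (k , ≤-refl , strict) , maxdeg
    where
    i? : Decidable (λ v → f v ≡ i)
    i? v = f v ≟ᶠ i
    strict : StrictlyDegenerate H (part f i) k
    strict Y F (Y⊆ , F⊆) Y≠∅ with D Y (λ v v∈Y → ∈⟦⟧⁻ i? (Y⊆ v∈Y)) Y≠∅
    ... | v , v∈Y , small = v , v∈Y , ≤-<-trans (degIn-≤ (_∈? Y) v (λ e e∈F → proj₂ (F⊆ e e∈F))) small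
    maxdeg : MaxDegInducedLe H (part f i) k
    maxdeg v v∈ = ≤-trans (degIn-≤ i? v (λ e e∈ u∈e → ∈⟦⟧⁻ i? (∈-inducedEdges e∈ u∈e))) (Δ i? v (∈⟦⟧⁻ i? v∈))

-- Adjacency, walks avoiding a vertex, and routes between its neighbours

module Adjacency (H : Hypergraph) where
  open Hyper H

  Adj : V → V → Set
  Adj x y = x ≢ y × ∃[ e ] (x ∈ inc H e × y ∈ inc H e)

  adj? : ∀ x y → Dec (Adj x y)
  adj? x y = ¬? (x ≟ᶠ y) ×-dec any? (λ e → (x ∈? inc H e) ×-dec (y ∈? inc H e))

  adj-sym : ∀ {x y} → Adj x y → Adj y x
  adj-sym (ne , e , x∈e , y∈e) = ne ∘ sym , e , y∈e , x∈e

  Walk : V → V → V → Set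
  Walk x = Star (λ u v → Adj u v × v ≢ x)

  -- Deleting `x` keeps the adjacency graph connected; an edge through `x` still links its other
  -- vertices.
  Noncut : V → Set
  Noncut x = ∀ u v → u ≢ x → v ≢ x → Walk x u v

  degree : V → ℕ
  degree v = # (λ e → v ∈? inc H e)

  together? : ∀ u v → Decidable (λ e → u ∈ inc H e × v ∈ inc H e)
  together? u v e = (u ∈? inc H e) ×-dec (v ∈? inc H e)

  w : V → V → ℕ
  w u v = # (together? u v)

  w-sym : ∀ u v → w u v ≡ w v u
  w-sym u v = #-cong (together? u v) (together? v u) (λ { _ (a , b) → b , a }) (λ { _ (a , b) → b , a })

  w-positive : ∀ {u v} → Adj u v → 1 ≤ w u v
  w-positive {u} {v} (_ , e , u∈e , v∈e) = #-positive (together? u v) (e , u∈e , v∈e)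

  module _ (x : V) where
    Out : V → Set
    Out v = v ≢ x × ¬ Adj x v

    -- A walk of positive length all of whose inner vertices avoid x and its neighbours.
    data Route : V → V → Set where
      last : ∀ {r y} → Adj r y → Route r y
      step : ∀ {r p y} → Adj r p → Out p → Route p y → Route r y

    On : ∀ {r y} → V → Route r y → Set
    On v (last _) = ⊥
    On v (step {p = p} _ _ R) = v ≡ p ⊎ On v R

    first : ∀ {r y} → Route r y → V
    first {y = y} (last _) = y
    first (step {p = p} _ _ _) = p

    on-out : ∀ {r y v} (R : Route r y) → On v R → Out v
    on-out (step _ out R) (inj₁ refl) = out
    on-out (step _ out R) (inj₂ on) = on-out R on

    -- A route with at least one inner vertex, whereas `Route` admits a single step.
    Via : V → V → Set
    Via z y = ∃[ p ] (Adj z p × Out p × Route p y)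

    -- Reversal with an accumulator: `back` is the part already traversed, turned around.
    reverse-onto : ∀ {r s y} → Out r → Route r s → Route r y → Via y s
    reverse-onto out back (last adj) = _ , adj-sym adj , out , back
    reverse-onto out back (step adj out' R) = reverse-onto out' (step (adj-sym adj) out back) R

    reverse-via : ∀ {z y} → Via z y → Via y z
    reverse-via (p , adj , out , R) = reverse-onto out (last (adj-sym adj)) R

    on-back : ∀ {r s y v} → Out r → Route r s → (R : Route r y) → On v R → Route v s
    on-back out back (step adj _ R) (inj₁ refl) = step (adj-sym adj) out back
    on-back out back (step adj out' R) (inj₂ on) = on-back out' (step (adj-sym adj) out back) R on

    -- The piece of `R` from `z` to its inner vertex `v`, reversed.
    route-back : ∀ {z y v} (R : Route z y) → On v R → Route v z
    route-back (step adj _ R) (inj₁ refl) = last (adj-sym adj)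
    route-back (step adj out R) (inj₂ on) = on-back out (last (adj-sym adj)) R on

    Chain : V → V → Set
    Chain = Star (λ z y → Adj x y × Route z y)

    -- Cuts a walk at its visits to neighbours of `x`: `z` is the first one met after `r`. The
    -- second alternative is the empty walk.
    chain-split : ∀ {r y} → Walk x r y → Adj x y →
      Σ V λ z → Adj x z × Route r z × Chain z y ⊎ r ≡ y
    chain-split {r} ε xy = r , inj₂ refl
    chain-split ((adj , r'≢x) ◅ walk) xy with chain-split walk xy
    chain-split {r} (_◅_ {j = r'} (adj , r'≢x) walk) xy | z , found with adj? x r'
    ... | no ¬xr' = case found
      where
      case : Adj x z × Route r' z × Chain z _ ⊎ r' ≡ _ → Σ V λ z → Adj x z × Route r z × Chain z _ ⊎ r ≡ _
      case (inj₁ (xz , R , C)) = z , inj₁ (xz , step adj (r'≢x , ¬xr') R , C)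
      case (inj₂ refl) = contradiction xy ¬xr'
    ... | yes xr' = r' , inj₁ (xr' , last adj , rest found)
      where
      rest : Adj x z × Route r' z × Chain z _ ⊎ r' ≡ _ → Chain r' _
      rest (inj₁ (xz , R , C)) = (xz , R) ◅ C
      rest (inj₂ refl) = ε

    chain : ∀ {r y} → Walk x r y → Adj x y → Chain r y
    chain walk xy with chain-split walk xy
    ... | z , inj₁ (xz , R , C) = (xz , R) ◅ C
    ... | z , inj₂ refl = ε

-- Components after deleting a vertex, and end blocks

module EndBlock (H : Hypergraph) (conn : Connected H) where
  open Hyper H
  open Adjacency H

  walk-sym : ∀ {x u v} → u ≢ x → Walk x u v → Walk x v u
  walk-sym u≢x ε = ε
  walk-sym u≢x ((adj , v≢x) ◅ walk) = walk-sym v≢x walk ◅◅ ((adj-sym adj , u≢x) ◅ ε)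

  -- The component of `u` after deleting `x`, by saturation: while the set is not closed it gains a
  -- vertex, so its complement shrinks.
  reachable : ∀ {x u} → u ≢ x → ∃[ S ] (u ∈ S × (∀ v → v ∈ S → v ≢ x × Walk x u v) ×
    (∀ v s → v ∈ S → Adj v s → s ≢ x → s ∈ S))
  reachable {x} {u} u≢x = go ⁅ u ⁆ (<-wellFounded _) (x∈⁅x⁆ u) start
    where
    start : ∀ v → v ∈ ⁅ u ⁆ → v ≢ x × Walk x u v
    start v v∈ with x∈⁅y⁆⇒x≡y u v∈
    ... | refl = u≢x , ε
    go : ∀ S → Acc _<_ ∣ ∁ S ∣ → u ∈ S → (∀ v → v ∈ S → v ≢ x × Walk x u v) →
      ∃[ S ] (u ∈ S × (∀ v → v ∈ S → v ≢ x × Walk x u v) × (∀ v s → v ∈ S → Adj v s → s ≢ x → s ∈ S))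
    go S (acc rec) u∈S reach
      with any? (λ v → any? (λ s → (v ∈? S) ×-dec (adj? v s ×-dec (¬? (s ≟ᶠ x) ×-dec ¬? (s ∈? S)))))
    ... | no none = S , u∈S , reach , closed
      where
      closed : ∀ v s → v ∈ S → Adj v s → s ≢ x → s ∈ S
      closed v s v∈S vs s≢x with s ∈? S
      ... | yes s∈S = s∈S
      ... | no s∉S = contradiction (v , s , v∈S , vs , s≢x , s∉S) none
    ... | yes (v , s , v∈S , vs , s≢x , s∉S) = go (S ∪ ⁅ s ⁆)
        (rec (p⊂q⇒∣p∣<∣q∣ (p⊂q⇒∁p⊃∁q (p⊆p∪q ⁅ s ⁆ , s , q⊆p∪q S ⁅ s ⁆ (x∈⁅x⁆ s) , s∉S))))
        (p⊆p∪q ⁅ s ⁆ u∈S) grow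
      where
      grow : ∀ t → t ∈ S ∪ ⁅ s ⁆ → t ≢ x × Walk x u t
      grow t t∈ with x∈p∪q⁻ S ⁅ s ⁆ t∈
      ... | inj₁ t∈S = reach t t∈S
      ... | inj₂ t∈s with x∈⁅y⁆⇒x≡y s t∈s
      ... | refl = s≢x , proj₂ (reach v v∈S) ◅◅ ((vs , s≢x) ◅ ε)

  -- A nonempty union of components left after deleting `c`. An inclusion-minimal one, together with
  -- `c`, plays the role of an end block.
  Separated : V → Subset (n H) → Set
  Separated c Y = c ∉ Y × Nonempty Y × (∀ y v → y ∈ Y → Adj y v → v ≢ c → v ∈ Y)

  -- Descent on |Y|: if y ∈ Y were a cut vertex, the part of Y cut off from c by y would be a smaller separated set.
  end-block : ∀ {c Y} → Separated c Y → ¬ (∀ c Y → Separated c Y → ¬ (∀ y → y ∈ Y → Noncut y))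
  end-block {c} {Y} sep never = go Y (<-wellFounded ∣ Y ∣) c sep
    where
    go : ∀ Y → Acc _<_ ∣ Y ∣ → ∀ c → ¬ Separated c Y
    go Y (acc rec) c (c∉Y , Y≠∅ , closed) = never c Y (c∉Y , Y≠∅ , closed) noncut
      where
      noncut : ∀ y → y ∈ Y → Noncut y
      noncut y y∈Y u v u≢y v≢y = walk-sym c≢y (proj₂ (reach u (everywhere u u≢y))) ◅◅ proj₂ (reach v (everywhere v v≢y))
        where
        c≢y : c ≢ y
        c≢y refl = c∉Y y∈Y
        -- `S` is the component of `c` without `y`; the part `Z` of `Y` outside `S` is cut off from
        -- `c` by `y`.
        S = proj₁ (reachable c≢y)
        c∈S = proj₁ (proj₂ (reachable c≢y))
        reach = proj₁ (proj₂ (proj₂ (reachable c≢y)))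
        S-closed = proj₂ (proj₂ (proj₂ (reachable c≢y)))
        X? : Decidable (λ t → t ≢ y × t ∉ S)
        X? t = ¬? (t ≟ᶠ y) ×-dec ¬? (t ∈? S)
        Z? : Decidable (λ t → t ∈ Y × t ≢ y × t ∉ S)
        Z? t = (t ∈? Y) ×-dec X? t
        Z-closed : ∀ t s → t ∈ ⟦ Z? ⟧ → Adj t s → s ≢ y → s ∈ ⟦ Z? ⟧
        Z-closed t s t∈Z ts s≢y with ∈⟦⟧⁻ Z? t∈Z
        ... | t∈Y , t≢y , t∉S = ∈⟦⟧⁺ Z? (closed t s t∈Y ts (λ { refl → s∉S c∈S }) , s≢y , s∉S)
          where
          s∉S : s ∉ S
          s∉S s∈S = t∉S (S-closed s t s∈S (adj-sym ts) t≢y)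
        everywhere : ∀ v → v ≢ y → v ∈ S
        everywhere v v≢y with v ∈? S
        ... | yes v∈S = v∈S
        ... | no v∉S with nonempty? ⟦ Z? ⟧
        ... | yes Z≠∅ = ⊥-elim (go ⟦ Z? ⟧ (rec (p⊂q⇒∣p∣<∣q∣
              ((λ t∈ → proj₁ (∈⟦⟧⁻ Z? t∈)) , y , y∈Y , λ y∈ → proj₁ (proj₂ (∈⟦⟧⁻ Z? y∈)) refl)))
              y ((λ y∈ → proj₁ (proj₂ (∈⟦⟧⁻ Z? y∈)) refl) , Z≠∅ , Z-closed))
        -- With `Z` empty, the vertices other than `y` outside `S` avoid `Y`. Connectedness gives an
        -- edge leaving this set, yet it can reach neither `y`, whose neighbours lie in `Y` or equal
        -- `c`, nor the component `S`.
        ... | no Z≡∅ with proj₂ conn ⟦ X? ⟧ (v , ∈⟦⟧⁺ X? (v≢y , v∉S)) (y , λ y∈ → proj₁ (∈⟦⟧⁻ X? y∈) refl)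
        ... | e , (t , t∈e , t∈X) , (s , s∈e , s∉X) = ⊥-elim (crossing (∈⟦⟧⁻ X? t∈X))
          where
          s≢t : s ≢ t
          s≢t refl = s∉X t∈X
          crossing : ¬ (t ≢ y × t ∉ S)
          crossing (t≢y , t∉S) with s ≟ᶠ y
          ... | yes refl = Z≡∅ (t , ∈⟦⟧⁺ Z? (closed y t y∈Y (s≢t , e , s∈e , t∈e) (λ { refl → t∉S c∈S }) , t≢y , t∉S))
          ... | no s≢y with s ∈? S
          ... | yes s∈S = t∉S (S-closed s t s∈S (s≢t , e , s∈e , t∈e) t≢y)
          ... | no s∉S = s∉X (∈⟦⟧⁺ X? (s≢y , s∉S))

  everything : ∀ {C : V → Set} (C? : Decidable C) {v} → C v → (∀ u s → C u → Adj u s → C s) → ∀ s → C s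
  everything C? {v} Cv closed s with C? s
  ... | yes Cs = Cs
  ... | no ¬Cs with proj₂ conn ⟦ C? ⟧ (v , ∈⟦⟧⁺ C? Cv) (s , ¬Cs ∘ ∈⟦⟧⁻ C?)
  ... | e , (t , t∈e , t∈C) , (r , r∈e , r∉C) =
        contradiction (∈⟦⟧⁺ C? (closed t r (∈⟦⟧⁻ C? t∈C) ((λ { refl → r∉C t∈C }) , e , t∈e , r∈e))) r∉C

-- Ordinary edges and multiplicities

module Multiplicity (H : Hypergraph) where
  open Hyper H
  open Adjacency H

  Pair : E → V → V → Set
  Pair e u v = ∀ s → s ∈ inc H e → s ≡ u ⊎ s ≡ v

  pair-ordinary : ∀ {e u v} → u ≢ v → u ∈ inc H e → v ∈ inc H e → Pair e u v → Ordinary H e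
  pair-ordinary {e} {u} {v} u≢v u∈e v∈e pair = begin
    ∣ inc H e ∣                 ≡⟨ ∣∣≡# (inc H e) ⟩
    # (_∈? inc H e)             ≡⟨ #-split (_≟ᶠ u) (_≟ᶠ v) (_∈? inc H e) (λ { _ refl → u∈e }) (λ { _ refl → v∈e })
                                     (λ { _ refl u≡v → u≢v u≡v }) pair ⟩
    # (_≟ᶠ u) + # (_≟ᶠ v)       ≡⟨ cong₂ _+_ (#-single u) (#-single v) ⟩
    2                           ∎
    where open ≡-Reasoning

  private
    joins? : ∀ u v → Decidable (λ e → inc H e ≡ ⁅ u ⁆ ∪ ⁅ v ⁆)
    joins? u v e = ≡-dec _≟ᵇ_ (inc H e) (⁅ u ⁆ ∪ ⁅ v ⁆)

    mult≡# : ∀ u v → mult H u v ≡ # (joins? u v)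
    mult≡# u v = trans (∣∣≡# ⟦ joins? u v ⟧)
      (#-cong (_∈? ⟦ joins? u v ⟧) (joins? u v) (λ e → ∈⟦⟧⁻ (joins? u v)) (λ e → ∈⟦⟧⁺ (joins? u v)))

    joins-∈ : ∀ {u v e} → inc H e ≡ ⁅ u ⁆ ∪ ⁅ v ⁆ → u ∈ inc H e × v ∈ inc H e
    joins-∈ {u} {v} eq = subst (u ∈_) (sym eq) (p⊆p∪q ⁅ v ⁆ (x∈⁅x⁆ u)) , subst (v ∈_) (sym eq) (q⊆p∪q ⁅ u ⁆ ⁅ v ⁆ (x∈⁅x⁆ v))

  -- `mult` counts edges equal to the pair and `w` counts edges containing it; the two agree once no
  -- such edge has a third vertex.
  mult≡w : ∀ {u v} → (∀ {e} → u ∈ inc H e → v ∈ inc H e → Pair e u v) → mult H u v ≡ w u v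
  mult≡w {u} {v} pair = trans (mult≡# u v) (#-cong (joins? u v) (together? u v) (λ e → joins-∈) back)
    where
    back : ∀ e → u ∈ inc H e × v ∈ inc H e → inc H e ≡ ⁅ u ⁆ ∪ ⁅ v ⁆
    back e (u∈e , v∈e) = ⊆-antisym sub sup
      where
      sub : inc H e ⊆ ⁅ u ⁆ ∪ ⁅ v ⁆
      sub {s} s∈e with pair u∈e v∈e s s∈e
      ... | inj₁ refl = p⊆p∪q ⁅ v ⁆ (x∈⁅x⁆ u)
      ... | inj₂ refl = q⊆p∪q ⁅ u ⁆ ⁅ v ⁆ (x∈⁅x⁆ v)
      sup : ⁅ u ⁆ ∪ ⁅ v ⁆ ⊆ inc H e
      sup {s} s∈ with x∈p∪q⁻ ⁅ u ⁆ ⁅ v ⁆ s∈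
      ... | inj₁ s∈u = subst (_∈ inc H e) (sym (x∈⁅y⁆⇒x≡y u s∈u)) u∈e
      ... | inj₂ s∈v = subst (_∈ inc H e) (sym (x∈⁅y⁆⇒x≡y v s∈v)) v∈e

  -- The diagonal `u ≡ v` is included, as `IsTC` asks for it: an edge with a single vertex
  -- contradicts `inc≥2`.
  mult≡0 : ∀ {u v} → ¬ Adj u v → mult H u v ≡ 0
  mult≡0 {u} {v} ¬uv = trans (mult≡# u v) (#-none (joins? u v) none)
    where
    none : ∀ e → inc H e ≢ ⁅ u ⁆ ∪ ⁅ v ⁆
    none e eq with joins-∈ eq | u ≟ᶠ v
    ... | u∈e , v∈e | no u≢v = ¬uv (u≢v , e , u∈e , v∈e)
    ... | u∈e , v∈e | yes refl with other u∈e
    ... | s , s∈e , s≢u with x∈p∪q⁻ ⁅ u ⁆ ⁅ u ⁆ (subst (s ∈_) eq s∈e)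
    ... | inj₁ s∈u = s≢u (x∈⁅y⁆⇒x≡y u s∈u)
    ... | inj₂ s∈u = s≢u (x∈⁅y⁆⇒x≡y u s∈u)

  inhabited : ∀ e → Nonempty (inc H e)
  inhabited e = #-exists (_∈? inc H e) (≤-trans (s≤s z≤n) (≤-trans (inc≥2 H e) (≤-reflexive (∣∣≡# (inc H e)))))

-- Exhaustive search for a partition

module Decide (H : Hypergraph) where
  open Hyper H

  degenerate? : ∀ {X : V → Set} → Decidable X → ∀ k → Dec (Degenerate X k)
  degenerate? {X} X? k with anySubset? (λ Y → all? (λ v → (v ∈? Y) →-dec X? v) ×-dec
    (nonempty? Y ×-dec ¬? (any? (λ v → (v ∈? Y) ×-dec (# (near? (_∈? Y) v) <? k)))))
  ... | yes (Y , Y⊆X , Y≠∅ , none) = no (λ D → none (D Y Y⊆X Y≠∅))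
  ... | no never = yes small
    where
    small : Degenerate X k
    small Y Y⊆X Y≠∅ with any? (λ v → (v ∈? Y) ×-dec (# (near? (_∈? Y) v) <? k))
    ... | yes found = found
    ... | no none = contradiction (Y , Y⊆X , Y≠∅ , none) never

  module _ (κ : Bool → ℕ) where
    open Split κ

    partition? : ∀ {X : V → Set} → Decidable X → ∀ f → Dec (Partition X f)
    partition? X? f with degenerate? (class? X? f true) (κ true) | degenerate? (class? X? f false) (κ false)
    ... | yes t | yes f' = yes λ { true → t ; false → f' }
    ... | no ¬t | _ = no λ P → ¬t (P true)
    ... | _ | no ¬f = no λ P → ¬f (P false)

    -- Finiteness makes the case distinction constructive. The negative answer covers every
    -- description `X` of the full vertex set.
    partition-search : (∃[ f ] Partition (_∈ ⊤) f) ⊎ (∀ f X → (∀ v → X v) → ¬ Partition X f)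
    partition-search with anySubset? (λ S → partition? (_∈? ⊤) (lookup S))
    ... | yes (S , P) = inj₁ (lookup S , P)
    ... | no none = inj₂ λ f X all P → none (tabulate f , λ c →
          degenerate-⊆ (λ { v (_ , eq) → all v , trans (sym (lookup∘tabulate f v)) eq }) (P c))

-- Maximum degree and parity

∈-max : ∀ {A : Set} (g : A → ℕ) {x xs} → x ∈ˡ xs → g x ≤ foldr _⊔_ 0 (map g xs)
∈-max g (here refl) = m≤m⊔n _ _
∈-max g (there x∈) = ≤-trans (∈-max g x∈) (m≤n⊔m _ _)

degree≤maxDeg : ∀ H v → Adjacency.degree H v ≤ maxDeg H
degree≤maxDeg H v = ≤-trans (≤-trans
  (#-mono (λ e → v ∈? inc H e) (_∈? incident H v) λ e v∈e →
    lookup⇒[]= e (incident H v) (trans (lookup∘tabulate (λ e → lookup (inc H e) v) e) ([]=⇒lookup v∈e)))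
  (≤-reflexive (sym (∣∣≡# (incident H v)))))
  (∈-max (deg H) (∈-allFin v))

flip-colour : ℕ → Bool → Bool
flip-colour zero b = b
flip-colour (suc k) b = not (flip-colour k b)

-- Only an odd number of flips changes a colour; the added 2 preserves parity and turns the number
-- of steps of an alternating path into the length of a cycle.
flip-odd : ∀ k {b} → flip-colour k b ≢ b → Odd (2 + k)
flip-odd zero ne = contradiction refl ne
flip-odd (suc zero) ne = refl
flip-odd (suc (suc k)) {b} ne = flip-odd k (ne ∘ trans (double-not (flip-colour k b)))

double-injective : ∀ {a b} → a + a ≡ b + b → a ≡ b
double-injective {a} {b} eq with <-cmp a b
... | tri< a<b _ _ = contradiction eq (<⇒≢ (+-mono-< a<b a<b))
... | tri≈ _ a≡b _ = a≡b
... | tri> _ _ b<a = contradiction (sym eq) (<⇒≢ (+-mono-< b<a b<a))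

-- The token game when no partition exists

module Game (H : Hypergraph) (conn : Connected H) (κ : Bool → ℕ) (κ≥1 : ∀ c → 1 ≤ κ c)
  (deg≤ : ∀ v → Adjacency.degree H v ≤ κ true + κ false)
  (stuck : ∀ f X → (∀ v → X v) → ¬ Hyper.Split.Partition H κ X f) where
  open Hyper H
  open Split κ
  open Adjacency H
  open EndBlock H conn
  open Multiplicity H

  K : ℕ
  K = κ true + κ false

  ≠? : (x : V) → Decidable (_≢ x)
  ≠? x v = ¬? (v ≟ᶠ x)

  -- A token sits on x; the remaining vertices are partitioned by f, whose value at x is irrelevant.
  Valid : V → (V → Bool) → Set
  Valid x f = Partition (_≢ x) f

  colourNear? : ∀ f c x → Decidable (Near (Class (_≢ x) f c) x)
  colourNear? f c x = near? (class? (≠? x) f c) x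

  colourDeg : (V → Bool) → Bool → V → ℕ
  colourDeg f c x = # (colourNear? f c x)

  near-deg : ∀ {X : V → Set} (X? : Decidable X) v → # (near? X? v) ≤ K
  near-deg X? v = ≤-trans (#-mono (near? X? v) (λ e → v ∈? inc H e) (λ e → proj₁)) (deg≤ v)

  -- In a proper vertex subset some vertex has an edge leaving the set, hence fewer than `K` edges
  -- inside. Removing such vertices one by one and inserting them in reverse order colours
  -- everything but `x`.
  valid-state : ∀ x → ∃[ f ] Valid x f
  valid-state x =
    let f , P = go X (<-wellFounded ∣ X ∣) (x , λ x∈X → ∈⟦⟧⁻ (≠? x) x∈X refl)
    in f , λ c → degenerate-⊆ (λ { v (ne , eq) → ∈⟦⟧⁺ (≠? x) ne , eq }) (P c)
    where
    X = ⟦ ≠? x ⟧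
    go : ∀ (X : Subset (n H)) → Acc _<_ ∣ X ∣ → (∃[ u ] u ∉ X) → ∃[ f ] Partition (_∈ X) f
    go X (acc rec) (u , u∉X) with nonempty? X
    ... | no empty = (λ _ → true) , λ c Y Y⊆X → λ { (v , v∈Y) → contradiction (v , proj₁ (Y⊆X v v∈Y)) empty }
    ... | yes X≠∅ with proj₂ conn X X≠∅ (u , u∉X)
    ... | e , (v , v∈e , v∈X) , (z , z∈e , z∉X)
      with go (X - v) (rec (x∈p⇒∣p-x∣<∣p∣ v∈X)) (u , u∉X ∘ p─q⊆p X ⁅ v ⁆)
    ... | f , P = partition-insert (_∈? (X - v)) v (split-off X) P
        (<-≤-trans (#-mono-< (near? (_∈? (X - v)) v) (λ e → v ∈? inc H e) (λ e → proj₁) e v∈e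
          (λ near → z∉X (p─q⊆p X ⁅ v ⁆ (proj₂ near z z∈e (λ { refl → z∉X v∈X }))))) (deg≤ v))

  module _ {x f} (valid : Valid x f) where
    private
      -- With fewer than `κ c` edges into class `c`, the vertex `x` could join it and complete a
      -- partition, against `stuck`.
      lower : ∀ c → κ c ≤ colourDeg f c x
      lower c = ≮⇒≥ λ lt → stuck (upd f x c) (λ v → v ≢ x ⊎ v ≡ x) all
        (partition-recolour (≠? x) x c (λ _ → id) valid lt)
        where
        all : ∀ v → v ≢ x ⊎ v ≡ x
        all v with v ≟ᶠ x
        ... | yes eq = inj₂ eq
        ... | no ne = inj₁ ne

      upper : colourDeg f true x + colourDeg f false x ≤ K
      upper = ≤-trans (class-degrees (≠? x) f x) (near-deg (≠? x) x)

    -- The two lower bounds add up to `K`, which bounds the degree of `x`, so both are attained.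
    colourDeg≡ : ∀ c → colourDeg f c x ≡ κ c
    colourDeg≡ true = ≤-antisym (+-cancelʳ-≤ (κ false) _ _ (≤-trans (+-monoʳ-≤ _ (lower false)) upper)) (lower true)
    colourDeg≡ false = ≤-antisym (+-cancelˡ-≤ (κ true) _ _ (≤-trans (+-monoˡ-≤ _ (lower true)) upper)) (lower false)

    degree≡ : degree x ≡ K
    degree≡ = ≤-antisym (deg≤ x) (≤-trans (+-mono-≤ (lower true) (lower false))
      (≤-trans (class-degrees (≠? x) f x) (#-mono (near? (≠? x) x) (λ e → x ∈? inc H e) (λ e → proj₁))))

    -- A two-coloured edge at `x` counts for neither class, but the edges that do count already
    -- exhaust the degree `K`.
    monochromatic : ∀ {e u v} → x ∈ inc H e → u ∈ inc H e → u ≢ x → v ∈ inc H e → v ≢ x → f u ≡ f v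
    monochromatic {e} {u} {v} x∈e u∈e u≢x v∈e v≢x with f u ≟ᵇ f v
    ... | yes eq = eq
    ... | no ne = contradiction
        (≤-trans (+-mono-≤ (lower true) (lower false)) ≤-refl)
        (<⇒≱ (<-≤-trans (#-disjoint-< (colourNear? f true x) (colourNear? f false x) (λ e → x ∈? inc H e)
          (λ e → proj₁) (λ e → proj₁) (λ e → classes-disjoint) e x∈e mixed mixed) (deg≤ x)))
      where
      mixed : ∀ {c} → ¬ Near (Class (_≢ x) f c) x e
      mixed (_ , near) = ne (trans (proj₂ (near u u∈e u≢x)) (sym (proj₂ (near v v∈e v≢x))))

    neighbour : ∀ c → ∃[ z ] (Adj x z × f z ≡ c)
    neighbour c with #-exists (colourNear? f c x) (subst (1 ≤_) (sym (colourDeg≡ c)) (κ≥1 c))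
    ... | e , x∈e , near with other x∈e
    ... | z , z∈e , z≢x = z , (z≢x ∘ sym , e , x∈e , z∈e) , proj₂ (near z z∈e z≢x)

    -- The move of the puzzle: `x` has exactly `κ (f y)` edges into the class of `y`. Once `y`
    -- leaves, an edge through `y` no longer counts, and `x` fits into that class.
    shift : ∀ {y} → Adj x y → Valid y (upd f x (f y))
    shift {y} (x≢y , e , x∈e , y∈e) = partition-recolour X? x (f y) split
      (λ c → degenerate-⊆ (λ { v ((v≢x , _) , eq) → v≢x , eq }) (valid c))
      (<-≤-trans (#-mono-< (near? (class? X? f (f y)) x) (colourNear? f (f y) x)
        (λ e → Near-mono λ { u _ ((u≢x , _) , eq) → u≢x , eq }) e
        (x∈e , λ u u∈e u≢x → u≢x , monochromatic x∈e u∈e u≢x y∈e (x≢y ∘ sym))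
        (λ near → proj₂ (proj₁ (proj₂ near y y∈e (x≢y ∘ sym))) refl)) (≤-reflexive (colourDeg≡ (f y))))
      where
      X? : Decidable (λ v → v ≢ x × v ≢ y)
      X? v = ≠? x v ×-dec ≠? y v
      split : ∀ u → u ≢ y → (u ≢ x × u ≢ y) ⊎ u ≡ x
      split u u≢y with u ≟ᶠ x
      ... | yes eq = inj₂ eq
      ... | no ne = inj₁ (ne , u≢y)

  -- Otherwise a token leaving x towards the colour not used by e and coming back to another
  -- vertex of e would find two colours on e.
  ordinary : ∀ {x} → Noncut x → ∀ {e u v} → x ∈ inc H e → u ∈ inc H e → u ≢ x → v ∈ inc H e → v ≢ x → u ≡ v
  ordinary {x} noncut {e} {u} {v} x∈e u∈e u≢x v∈e v≢x with u ≟ᶠ v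
  ... | yes eq = eq
  ... | no u≢v with valid-state x
  ... | f , valid with neighbour valid (not (f u))
  ... | z , xz , fz = ⊥-elim (run (noncut z u (proj₁ xz ∘ sym) u≢x) (shift valid xz) z∉e
          (trans (upd-eq f x (f z)) fz)
          (λ t t∈e t≢x → trans (upd-neq f x (f z) t≢x) (monochromatic valid x∈e t∈e t≢x u∈e u≢x)))
    where
    z∉e : z ∉ inc H e
    z∉e z∈e = not-¬ refl (trans (sym (monochromatic valid x∈e z∈e (proj₁ xz ∘ sym) u∈e u≢x)) fz)
    -- Until the token first enters `e`, `x` has one colour and the rest of `e` the other. At the
    -- entry `y'`, the vertices `x` and `t` then contradict `monochromatic`.
    run : ∀ {y g} → Walk x y u → Valid y g → y ∉ inc H e → g x ≡ not (f u) →
      (∀ t → t ∈ inc H e → t ≢ x → g t ≡ f u) → ⊥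
    run ε _ y∉e _ _ = y∉e u∈e
    run {y} {g} (_◅_ {j = y'} (yy' , y'≢x) walk) val y∉e gx ge with y' ∈? inc H e
    ... | no y'∉e = run walk (shift val yy') y'∉e (trans (upd-neq g y _ (λ { refl → y∉e x∈e })) gx)
                      (λ t t∈e t≢x → trans (upd-neq g y _ (λ { refl → y∉e t∈e })) (ge t t∈e t≢x))
    ... | yes y'∈e with third
      where
      third : ∃[ t ] (t ∈ inc H e × t ≢ x × t ≢ y')
      third with u ≟ᶠ y'
      ... | yes refl = v , v∈e , v≢x , u≢v ∘ sym
      ... | no u≢y' = u , u∈e , u≢x , u≢y'
    ... | t , t∈e , t≢x , t≢y' = not-¬ refl (begin
        f u                  ≡⟨ ge t t∈e t≢x ⟨
        g t                  ≡⟨ upd-neq g y _ (λ { refl → y∉e t∈e }) ⟨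
        upd g y (g y') t     ≡⟨ monochromatic (shift val yy') y'∈e t∈e t≢y' x∈e (y'≢x ∘ sym) ⟩
        upd g y (g y') x     ≡⟨ upd-neq g y _ (λ { refl → y∉e x∈e }) ⟩
        g x                  ≡⟨ gx ⟩
        not (f u)            ∎)
      where open ≡-Reasoning

  -- Permuting the colours around a non-cut vertex

  module _ {x : V} (noncut : Noncut x) where

    private
      edge-near : ∀ {f c e u} → x ∈ inc H e → u ∈ inc H e → u ≢ x → f u ≡ c → Near (Class (_≢ x) f c) x e
      edge-near {f} x∈e u∈e u≢x fu = x∈e , λ t t∈e t≢x → t≢x , trans (cong f (ordinary noncut x∈e t∈e t≢x u∈e u≢x)) fu

    -- In both states exactly `κ c` edges join `x` to class `c`, so the neighbours of colour `c` in
    -- `g` cannot form a proper subset of those in `f`.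
    colour-balance : ∀ {f g c u} → Valid x f → Valid x g → Adj x u → f u ≡ c → g u ≢ c →
      ¬ (∀ v → Adj x v → g v ≡ c → f v ≡ c)
    colour-balance {f} {g} {c} {u} vf vg (x≢u , e , x∈e , u∈e) fu gu sub = <-irrefl
      (trans (colourDeg≡ vg c) (sym (colourDeg≡ vf c)))
      (#-mono-< (colourNear? g c x) (colourNear? f c x)
        (λ { e (x∈e , near) → x∈e , λ t t∈e t≢x → t≢x , sub t (t≢x ∘ sym , e , x∈e , t∈e) (proj₂ (near t t∈e t≢x)) })
        e (edge-near x∈e u∈e (x≢u ∘ sym) fu) (λ near → gu (proj₂ (proj₂ near u u∈e (x≢u ∘ sym)))))

    -- The last move goes from `y` to `x`, and `x` has kept its colour since `R` avoids it; hence
    -- `y` ends with `h x`.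
    run : ∀ {r y h} (R : Route x r y) → Valid r h → r ≢ x → Adj x y →
      ∃[ g ] (Valid x g × g y ≡ h x × (∀ v → v ≢ y → v ≢ x → v ≢ r → ¬ On x v R → g v ≡ h v))
    run {r} {y} {h} (last adj) val r≢x xy =
      upd h₁ y (h₁ x) , shift (shift val adj) (adj-sym xy) ,
      trans (upd-eq h₁ y (h₁ x)) (upd-neq h r (h y) (r≢x ∘ sym)) ,
      λ v v≢y v≢x v≢r _ → trans (upd-neq h₁ y (h₁ x) v≢y) (upd-neq h r (h y) v≢r)
      where h₁ = upd h r (h y)
    run {r} {y} {h} (step {p = p} adj out R) val r≢x xy with run R (shift val adj) (proj₁ out) xy
    ... | g , vg , gy , rest = g , vg , trans gy (upd-neq h r (h p) (r≢x ∘ sym)) ,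
        λ v v≢y v≢x v≢r off → trans (rest v v≢y v≢x (off ∘ inj₁) (off ∘ inj₂)) (upd-neq h r (h p) v≢r)

    -- The token goes from x to z, along R to y, and back to x.
    round-trip : ∀ {f z y} → Valid x f → Adj x z → Adj x y → z ≢ y → (R : Route x z y) →
      ∃[ g ] (Valid x g × g y ≡ f z × g z ≡ f (first x R) ×
              (∀ v → v ≢ z → v ≢ y → v ≢ x → ¬ On x v R → g v ≡ f v))
    round-trip {f} {z} {y} val xz xy z≢y (last adj) =
      upd h₁ y (h₁ x) , shift (shift (shift val xz) adj) (adj-sym xy) ,
      trans (upd-eq h₁ y (h₁ x)) (trans (upd-neq h z (h y) (proj₁ xz)) (upd-eq f x (f z))) ,
      trans (upd-neq h₁ y (h₁ x) z≢y) (trans (upd-eq h z (h y)) (upd-neq f x (f z) (proj₁ xy ∘ sym))) ,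
      λ v v≢z v≢y v≢x _ → trans (upd-neq h₁ y (h₁ x) v≢y) (trans (upd-neq h z (h y) v≢z) (upd-neq f x (f z) v≢x))
      where
      h = upd f x (f z)
      h₁ = upd h z (h y)
    round-trip {f} {z} {y} val xz xy z≢y (step {p = p} adj out R)
      with run R (shift (shift val xz) adj) (proj₁ out) xy
    ... | g , vg , gy , rest = g , vg ,
        trans gy (trans (upd-neq h z (h p) (proj₁ xz)) (upd-eq f x (f z))) ,
        trans (rest z z≢y (proj₁ xz ∘ sym) (λ { refl → proj₂ out xz }) (λ on → proj₂ (on-out x R on) xz))
          (trans (upd-eq h z (h p)) (upd-neq f x (f z) (proj₁ out))) ,
        λ v v≢z v≢y v≢x off → trans (rest v v≢y v≢x (off ∘ inj₁) (off ∘ inj₂))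
          (trans (upd-neq h z (h p) v≢z) (upd-neq f x (f z) v≢x))
      where h = upd f x (f z)

    private
      -- After the round trip `y` has the old colour of `z`, and `z` that of the first vertex on
      -- `R`; no other neighbour of `x` changes. By `colour-balance` the colour lost at `y` must
      -- reappear at `z`.
      returns : ∀ {f z y} (val : Valid x f) (xz : Adj x z) (xy : Adj x y) (z≢y : z ≢ y) (R : Route x z y) →
        f (first x R) ≡ f y
      returns {f} {z} {y} val xz xy z≢y R with round-trip val xz xy z≢y R
      ... | g , vg , gy , gz , rest with f (first x R) ≟ᵇ f y
      ... | yes eq = eq
      ... | no ne with f z ≟ᵇ f y
      ... | yes same = contradiction sub (colour-balance val vg xz same (ne ∘ trans (sym gz)))
        where
        sub : ∀ v → Adj x v → g v ≡ f y → f v ≡ f y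
        sub v xv gv with v ≟ᶠ z | v ≟ᶠ y
        ... | yes refl | _ = same
        ... | no _ | yes refl = refl
        ... | no v≢z | no v≢y = trans (sym (rest v v≢z v≢y (proj₁ xv ∘ sym) (λ on → proj₂ (on-out x R on) xv))) gv
      ... | no differ = contradiction sub (colour-balance vg val xy gy (differ ∘ sym))
        where
        sub : ∀ v → Adj x v → f v ≡ f z → g v ≡ f z
        sub v xv fv with v ≟ᶠ z | v ≟ᶠ y
        ... | yes refl | _ = trans gz (other-colour ne differ)
        ... | no _ | yes refl = gy
        ... | no v≢z | no v≢y = trans (rest v v≢z v≢y (proj₁ xv ∘ sym) (λ on → proj₂ (on-out x R on) xv)) fv

    excursion : ∀ {f z y} → Valid x f → Adj x z → Adj x y → z ≢ y → (R : Route x z y) →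
      ∃[ g ] (Valid x g × g z ≡ f y × g y ≡ f z × (∀ v → v ≢ z → v ≢ y → v ≢ x → ¬ On x v R → g v ≡ f v))
    excursion val xz xy z≢y R with round-trip val xz xy z≢y R
    ... | g , vg , gy , gz , rest = g , vg , trans gz (returns val xz xy z≢y R) , gy , rest

    -- The key constraint on vertices outside N[x]: in every valid state the first inner vertex of a
    -- route to `y` shares the colour of `y`.
    via-colour : ∀ {f z y p} → Valid x f → Adj x z → Adj x y → z ≢ y →
      Adj z p → Out x p → Route x p y → f p ≡ f y
    via-colour val xz xy z≢y zp out R = returns val xz xy z≢y (step zp out R)

    Swap : V → V → (V → Bool) → Set
    Swap z y f = ∃[ g ] (Valid x g × g z ≡ f y × g y ≡ f z × (∀ v → Adj x v → v ≢ z → v ≢ y → g v ≡ f v))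

    -- Conjugation of transpositions along the chain: (z y) = (z u)(u y)(z u).
    swap-along : ∀ {z y} → Chain x z y → Adj x z → Adj x y → z ≢ y → ∀ {f} → Valid x f → Swap z y f
    swap-along ε xz xy z≢y val = contradiction refl z≢y
    swap-along {z} {y} (_◅_ {j = u} (xu , R) C) xz xy z≢y {f} val with u ≟ᶠ z | u ≟ᶠ y
    ... | yes refl | _ = swap-along C xz xy z≢y val
    ... | no u≢z | yes refl with excursion val xz xy z≢y R
    ...   | g , vg , gz , gy , rest = g , vg , gz , gy ,
            λ v xv v≢z v≢y → rest v v≢z v≢y (proj₁ xv ∘ sym) (λ on → proj₂ (on-out x R on) xv)
    swap-along {z} {y} (_◅_ {j = u} (xu , R) C) xz xy z≢y {f} val | no u≢z | no u≢y
      with excursion val xz xu (u≢z ∘ sym) R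
    ... | g₁ , v₁ , z₁ , u₁ , r₁ with swap-along C xu xy u≢y v₁
    ... | g₂ , v₂ , u₂ , y₂ , r₂ with excursion v₂ xz xu (u≢z ∘ sym) R
    ... | g₃ , v₃ , z₃ , u₃ , r₃ = g₃ , v₃ ,
          trans z₃ (trans u₂ (keep₁ y xy (z≢y ∘ sym) (u≢y ∘ sym))) ,
          trans (keep₃ y xy (z≢y ∘ sym) (u≢y ∘ sym)) (trans y₂ u₁) ,
          others
      where
      keep₁ : ∀ v → Adj x v → v ≢ z → v ≢ u → g₁ v ≡ f v
      keep₁ v xv v≢z v≢u = r₁ v v≢z v≢u (proj₁ xv ∘ sym) (λ on → proj₂ (on-out x R on) xv)
      keep₃ : ∀ v → Adj x v → v ≢ z → v ≢ u → g₃ v ≡ g₂ v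
      keep₃ v xv v≢z v≢u = r₃ v v≢z v≢u (proj₁ xv ∘ sym) (λ on → proj₂ (on-out x R on) xv)
      others : ∀ v → Adj x v → v ≢ z → v ≢ y → g₃ v ≡ f v
      others v xv v≢z v≢y with v ≟ᶠ u
      ... | yes refl = trans u₃ (trans (r₂ z xz (u≢z ∘ sym) z≢y) z₁)
      ... | no v≢u = trans (keep₃ v xv v≢z v≢u) (trans (r₂ v xv v≢u v≢y) (keep₁ v xv v≢z v≢u))

    chain-of : ∀ {z y} → Adj x z → Adj x y → Chain x z y
    chain-of {z} {y} xz xy = chain x (noncut z y (proj₁ xz ∘ sym) (proj₁ xy ∘ sym)) xy

    swap : ∀ {z y} → Adj x z → Adj x y → z ≢ y → ∀ {f} → Valid x f → Swap z y f
    swap xz xy = swap-along (chain-of xz xy) xz xy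

    -- If `u` and `v` agree, exchange `v` with a neighbour of `x` of the other colour.
    separate : ∀ {u v} → Adj x u → Adj x v → u ≢ v → ∃[ f ] (Valid x f × f u ≢ f v)
    separate {u} {v} xu xv u≢v with valid-state x
    ... | f , val with f u ≟ᵇ f v
    ... | no ne = f , val , ne
    ... | yes eq with neighbour val (not (f u))
    ... | z , xz , fz with swap xv xz (λ v≡z → not-¬ refl (trans eq (trans (cong f v≡z) fz))) val
    ... | g , vg , gv , _ , rest = g , vg , λ guv → not-¬ refl
        (trans (sym (rest u xu u≢v (λ u≡z → not-¬ refl (trans (cong f u≡z) fz)))) (trans guv (trans gv fz)))

    private
      weight-split : ∀ {f c u} → Adj x u → f u ≡ c →
        let rest? = λ e → colourNear? f c x e ×-dec ¬? (u ∈? inc H e) in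
        colourDeg f c x ≡ # rest? + w x u
      weight-split {f} {c} {u} xu fu = #-split rest? (together? x u) (colourNear? f c x)
        (λ e → proj₁) (λ { e (x∈e , u∈e) → edge-near x∈e u∈e (proj₁ xu ∘ sym) fu })
        (λ { e (_ , u∉e) (_ , u∈e) → u∉e u∈e }) cover
        where
        rest? = λ e → colourNear? f c x e ×-dec ¬? (u ∈? inc H e)
        cover : ∀ e → Near (Class (_≢ x) f c) x e →
          (Near (Class (_≢ x) f c) x e × u ∉ inc H e) ⊎ (x ∈ inc H e × u ∈ inc H e)
        cover e near with u ∈? inc H e
        ... | yes u∈e = inj₂ (proj₁ near , u∈e)
        ... | no u∉e = inj₁ (near , u∉e)

      -- Swapping the colours of `u` and `v` replaces the edges to `u` by those to `v` in the class
      -- of colour `f u` at `x`, while the count stays `κ (f u)`.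
      weight-transfer : ∀ {f u v} → Adj x u → Adj x v → Valid x f → f u ≢ f v → w x u ≡ w x v
      weight-transfer {f} {u} {v} xu xv val ne with swap xu xv (λ { refl → ne refl }) val
      ... | g , vg , gu , gv , rest = +-cancelˡ-≡ (# restf?) _ _ (begin
          # restf? + w x u          ≡⟨ weight-split xu refl ⟨
          colourDeg f (f u) x       ≡⟨ colourDeg≡ val (f u) ⟩
          κ (f u)                   ≡⟨ colourDeg≡ vg (f u) ⟨
          colourDeg g (f u) x       ≡⟨ weight-split xv gv ⟩
          # restg? + w x v          ≡⟨ cong (_+ w x v) (#-cong restg? restf? back forth) ⟩
          # restf? + w x v          ∎)
        where
        open ≡-Reasoning
        restf? = λ e → colourNear? f (f u) x e ×-dec ¬? (u ∈? inc H e)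
        restg? = λ e → colourNear? g (f u) x e ×-dec ¬? (v ∈? inc H e)
        adj : ∀ {e t} → x ∈ inc H e → t ∈ inc H e → t ≢ x → Adj x t
        adj x∈e t∈e t≢x = t≢x ∘ sym , _ , x∈e , t∈e
        forth : ∀ e → Near (Class (_≢ x) f (f u)) x e × u ∉ inc H e → Near (Class (_≢ x) g (f u)) x e × v ∉ inc H e
        forth e ((x∈e , near) , u∉e) = (x∈e , λ t t∈e t≢x → t≢x ,
            trans (rest t (adj x∈e t∈e t≢x) (λ { refl → u∉e t∈e }) (λ { refl → v∉e t∈e })) (proj₂ (near t t∈e t≢x))) , v∉e
          where
          v∉e : v ∉ inc H e
          v∉e v∈e = ne (sym (proj₂ (near v v∈e (proj₁ xv ∘ sym))))
        back : ∀ e → Near (Class (_≢ x) g (f u)) x e × v ∉ inc H e → Near (Class (_≢ x) f (f u)) x e × u ∉ inc H e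
        back e ((x∈e , near) , v∉e) = (x∈e , λ t t∈e t≢x → t≢x ,
            trans (sym (rest t (adj x∈e t∈e t≢x) (λ { refl → u∉e t∈e }) (λ { refl → v∉e t∈e }))) (proj₂ (near t t∈e t≢x))) , u∉e
          where
          u∉e : u ∉ inc H e
          u∉e u∈e = ne (trans (sym (proj₂ (near u u∈e (proj₁ xu ∘ sym)))) gu)

    weight-constant : ∀ {u v} → Adj x u → Adj x v → w x u ≡ w x v
    weight-constant {u} {v} xu xv with u ≟ᶠ v
    ... | yes refl = refl
    ... | no u≢v with separate xu xv u≢v
    ... | f , val , ne = weight-transfer xu xv val ne

    -- Otherwise `via-colour`, used in both directions, gives `p` the colours of `u` and of `v`,
    -- even in a state where these differ.
    neighbours-closed : ∀ {u v p} → Adj x u → Adj x v → u ≢ v → p ≢ x → Adj u p → Adj p v → Adj x p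
    neighbours-closed {u} {v} {p} xu xv u≢v p≢x up pv with adj? x p
    ... | yes xp = xp
    ... | no ¬xp with separate xu xv u≢v
    ... | f , val , ne = contradiction
          (trans (sym (via-colour val xv xu (u≢v ∘ sym) (adj-sym pv) (p≢x , ¬xp) (last (adj-sym up))))
            (via-colour val xu xv u≢v up (p≢x , ¬xp) (last pv))) ne

    module _ {t₁ t₂ t₃ : V} (x₁ : Adj x t₁) (x₂ : Adj x t₂) (x₃ : Adj x t₃)
      (d₁₂ : t₁ ≢ t₂) (d₁₃ : t₁ ≢ t₃) (d₂₃ : t₂ ≢ t₃) where
      private
        third : ∀ z y → ∃[ u ] (Adj x u × u ≢ z × u ≢ y)
        third z y with t₁ ≟ᶠ z | t₁ ≟ᶠ y | t₂ ≟ᶠ z | t₂ ≟ᶠ y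
        ... | no a | no b | _ | _ = t₁ , x₁ , a , b
        ... | _ | _ | no a | no b = t₂ , x₂ , a , b
        ... | yes refl | _ | yes refl | _ = contradiction refl d₁₂
        ... | _ | yes refl | _ | yes refl = contradiction refl d₁₂
        ... | yes refl | _ | _ | yes refl = t₃ , x₃ , d₁₃ ∘ sym , d₂₃ ∘ sym
        ... | _ | yes refl | yes refl | _ = t₃ , x₃ , d₂₃ ∘ sym , d₁₃ ∘ sym

        -- A vertex p between z and y always has the colour of y, so the excursion through R
        -- cannot avoid p; hence p can also be reached from u, and has the colour of u as well.
        no-hop : ∀ {z y u} → Adj x z → Adj x y → z ≢ y → Via x z y →
          Adj x u → u ≢ z → u ≢ y → ¬ Route x u y
        no-hop {z} {y} {u} xz xy z≢y (p , zp , out , Q) xu u≢z u≢y R with separate xu xy u≢y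
        ... | f , val , ne with excursion val xu xy u≢y R
        ... | g , vg , gu , gy , rest = contradiction fixed (λ gp → ne (begin
              f u  ≡⟨ gy ⟨
              g y  ≡⟨ via-colour vg xz xy z≢y zp out Q ⟨
              g p  ≡⟨ gp ⟩
              f p  ≡⟨ via-colour val xz xy z≢y zp out Q ⟩
              f y  ∎))
          where
          open ≡-Reasoning
          off : ¬ On x p R
          off on = ne (trans (sym (via-colour val xz xu (u≢z ∘ sym) zp out (route-back x R on)))
            (via-colour val xz xy z≢y zp out Q))
          fixed : g p ≡ f p
          fixed = rest p (λ { refl → proj₂ out xu }) (λ { refl → proj₂ out xy }) (proj₁ out) off

      -- A chain leads from some third neighbour to `z`. Its first route arriving at `z` or `y`
      -- starts at a further neighbour, which `no-hop` forbids.
      no-via : ∀ {z y} → Adj x z → Adj x y → z ≢ y → ¬ Via x z y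
      no-via {z} {y} xz xy z≢y via with third z y
      ... | u , xu , u≢z , u≢y = follow xu u≢z u≢y (chain-of xu xz)
        where
        follow : ∀ {u} → Adj x u → u ≢ z → u ≢ y → ¬ Chain x u z
        follow xu u≢z u≢y ε = u≢z refl
        follow {u} xu u≢z u≢y (_◅_ {j = u'} (xu' , R) C) with u' ≟ᶠ z | u' ≟ᶠ y
        ... | yes refl | _ = no-hop xy xz (z≢y ∘ sym) (reverse-via x via) xu u≢y u≢z R
        ... | no _ | yes refl = no-hop xz xy z≢y via xu u≢z u≢y R
        ... | no a | no b = follow xu' a b C

      -- By `no-via` a route between distinct neighbours is a single step; routes returning to their
      -- start are dropped.
      adjacency-chain : ∀ {u v} → Chain x u v → Adj x u → Star (λ u v → Adj x v × Adj u v) u v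
      adjacency-chain ε xu = ε
      adjacency-chain ((xu' , last adj) ◅ C) xu = (xu' , adj) ◅ adjacency-chain C xu'
      adjacency-chain {u} (_◅_ {j = u'} (xu' , step {p = p} adj out R) C) xu with u ≟ᶠ u'
      ... | yes refl = adjacency-chain C xu'
      ... | no ne = contradiction (p , adj , out , R) (no-via xu xu' ne)

  -- Blocks with a complete neighbourhood

  module _ {c : V} {Y : Subset (n H)} (sep : Separated c Y) (noncut : ∀ y → y ∈ Y → Noncut y) where

    InBlock : V → Set
    InBlock v = v ≡ c ⊎ v ∈ Y

    neighbour-in-block : ∀ {x v} → x ∈ Y → Adj x v → InBlock v
    neighbour-in-block {x} {v} x∈Y xv with v ≟ᶠ c
    ... | yes v≡c = inj₁ v≡c
    ... | no v≢c = inj₂ (proj₂ (proj₂ sep) x v x∈Y xv v≢c)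

    -- Two distinct vertices of the block cannot both be `c`, so `ordinary` applies at one of them.
    block-pair : ∀ {e u v} → InBlock u → InBlock v → u ≢ v → u ∈ inc H e → v ∈ inc H e → Pair e u v
    block-pair (inj₁ refl) (inj₁ refl) u≢v u∈e v∈e s s∈e = contradiction refl u≢v
    block-pair {u = u} (inj₂ u∈Y) _ u≢v u∈e v∈e s s∈e with s ≟ᶠ u
    ... | yes s≡u = inj₁ s≡u
    ... | no s≢u = inj₂ (ordinary (noncut _ u∈Y) u∈e s∈e s≢u v∈e (u≢v ∘ sym))
    block-pair {v = v} _ (inj₂ v∈Y) u≢v u∈e v∈e s s∈e with s ≟ᶠ v
    ... | yes s≡v = inj₂ s≡v
    ... | no s≢v = inj₁ (ordinary (noncut _ v∈Y) v∈e s∈e s≢v u∈e u≢v)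

    module _ {x y₀} (x∈Y : x ∈ Y) (xy₀ : Adj x y₀) (clique : ∀ {u v} → Adj x u → Adj x v → u ≢ v → Adj u v) where
      private
        D : V → Set
        D v = v ≡ x ⊎ Adj x v

        D? : Decidable D
        D? v = (v ≟ᶠ x) ⊎-dec adj? x v

        D-block : ∀ {v} → D v → InBlock v
        D-block (inj₁ refl) = inj₂ x∈Y
        D-block (inj₂ xv) = neighbour-in-block x∈Y xv

        t : ℕ
        t = w x y₀

        w-at-x : ∀ {v} → Adj x v → w x v ≡ t
        w-at-x xv = weight-constant (noncut x x∈Y) xv xy₀

        w-at : ∀ {u v} → u ∈ Y → Adj x u → Adj x v → u ≢ v → w u v ≡ t
        w-at {u} {v} u∈Y xu xv u≢v = begin
          w u v  ≡⟨ weight-constant (noncut u u∈Y) (clique xu xv u≢v) (adj-sym xu) ⟩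
          w u x  ≡⟨ w-sym u x ⟩
          w x u  ≡⟨ w-at-x xu ⟩
          t      ∎
          where open ≡-Reasoning

        w≡t : ∀ {u v} → D u → D v → u ≢ v → w u v ≡ t
        w≡t (inj₁ refl) (inj₁ refl) u≢v = contradiction refl u≢v
        w≡t (inj₁ refl) (inj₂ xv) u≢v = w-at-x xv
        w≡t {u} (inj₂ xu) (inj₁ refl) u≢v = trans (w-sym u x) (w-at-x xu)
        w≡t {u} {v} (inj₂ xu) (inj₂ xv) u≢v with neighbour-in-block x∈Y xu | neighbour-in-block x∈Y xv
        ... | inj₂ u∈Y | _ = w-at u∈Y xu xv u≢v
        ... | _ | inj₂ v∈Y = trans (w-sym u v) (w-at v∈Y xv xu (u≢v ∘ sym))
        ... | inj₁ refl | inj₁ refl = contradiction refl u≢v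

        Rest : V → V → Set
        Rest y v = D v × v ≢ y

        rest? : ∀ y → Decidable (Rest y)
        rest? y v = D? v ×-dec ¬? (v ≟ᶠ y)

        Inner : V → E → Set
        Inner y e = y ∈ inc H e × ∃[ v ] (Rest y v × v ∈ inc H e)

        inner? : ∀ y → Decidable (Inner y)
        inner? y e = (y ∈? inc H e) ×-dec any? (λ v → rest? y v ×-dec (v ∈? inc H e))

        inner-count : ∀ {y} → D y → # (inner? y) ≡ t * # (rest? y)
        inner-count {y} Dy = double-count {R = R} (inner? y) (rest? y) R? t row proj₁
          (λ { {v} (r , y∈e , v∈e) → y∈e , v , r , v∈e }) unique (λ { (y∈e , v , r , v∈e) → v , r , y∈e , v∈e })
          where
          R : V → E → Set
          R v e = Rest y v × y ∈ inc H e × v ∈ inc H e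
          R? : ∀ v → Decidable (R v)
          R? v e = rest? y v ×-dec together? y v e
          row : ∀ v → Rest y v → # (R? v) ≡ t
          row v (Dv , v≢y) = trans (#-cong (R? v) (together? y v) (λ _ → proj₂) (λ _ yv → (Dv , v≢y) , yv)) (w≡t Dy Dv (v≢y ∘ sym))
          unique : ∀ {u v e} → R u e → R v e → u ≡ v
          unique {u} {v} ((Du , u≢y) , y∈e , u∈e) ((Dv , v≢y) , _ , v∈e)
            with block-pair (D-block Dy) (D-block Du) (u≢y ∘ sym) y∈e u∈e v v∈e
          ... | inj₁ v≡y = contradiction v≡y v≢y
          ... | inj₂ v≡u = sym v≡u

        rest-count : ∀ {y} → D y → # (rest? y) ≡ # (rest? x)
        rest-count {y} Dy = +-cancelʳ-≡ 1 _ _ (trans (sym (size Dy)) (size (inj₁ refl)))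
          where
          size : ∀ {y} → D y → # D? ≡ # (rest? y) + 1
          size {y} Dy = trans (#-split (rest? y) (_≟ᶠ y) D? (λ _ → proj₁) (λ { _ refl → Dy }) (λ { _ (_ , ne) refl → ne refl }) cover)
            (cong (# (rest? y) +_) (#-single y))
            where
            cover : ∀ v → D v → Rest y v ⊎ v ≡ y
            cover v Dv with v ≟ᶠ y
            ... | yes eq = inj₂ eq
            ... | no ne = inj₁ (Dv , ne)

        -- Every vertex of `D` has t(|D| - 1) edges to the rest of `D`. At `x` these are all its
        -- edges, so the number is `K`; hence even at `c` no edge is left over to leave the block.
        inner-full : ∀ {y} → D y → # (inner? y) ≡ K
        inner-full {y} Dy = begin
          # (inner? y)         ≡⟨ inner-count Dy ⟩
          t * # (rest? y)      ≡⟨ cong (t *_) (rest-count Dy) ⟩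
          t * # (rest? x)      ≡⟨ inner-count (inj₁ refl) ⟨
          # (inner? x)         ≡⟨ #-cong (inner? x) (λ e → x ∈? inc H e) (λ _ → proj₁) total ⟩
          degree x             ≡⟨ degree≡ (proj₂ (valid-state x)) ⟩
          K                    ∎
          where
          open ≡-Reasoning
          total : ∀ e → x ∈ inc H e → Inner x e
          total e x∈e = let v , v∈e , v≢x = other x∈e in x∈e , v , (inj₂ (v≢x ∘ sym , e , x∈e , v∈e) , v≢x) , v∈e

        all-inner : ∀ {y e} → D y → y ∈ inc H e → Inner y e
        all-inner {y} {e} Dy y∈e with inner? y e
        ... | yes inner = inner
        ... | no ¬inner = contradiction (deg≤ y) (<⇒≱ (≤-<-trans (≤-reflexive (sym (inner-full Dy)))
                (#-mono-< (inner? y) (λ e → y ∈? inc H e) (λ _ → proj₁) e y∈e ¬inner)))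

        all-D : ∀ v → D v
        all-D = everything D? (inj₁ refl) closed
          where
          closed : ∀ u s → D u → Adj u s → D s
          closed u s Du (u≢s , e , u∈e , s∈e) with all-inner Du u∈e
          ... | _ , v , (Dv , v≢u) , v∈e with block-pair (D-block Du) (D-block Dv) (v≢u ∘ sym) u∈e v∈e s s∈e
          ... | inj₁ refl = Du
          ... | inj₂ refl = Dv

        pairs : ∀ {u v} → u ≢ v → ∀ {e} → u ∈ inc H e → v ∈ inc H e → Pair e u v
        pairs {u} {v} u≢v = block-pair (D-block (all-D u)) (D-block (all-D v)) u≢v

      clique⇒tK : ∃[ t ] (1 ≤ t × IsTK H t (n H))
      clique⇒tK = t , w-positive xy₀ , refl , all-ordinary ,
        λ u v u≢v → trans (mult≡w (pairs u≢v)) (w≡t (all-D u) (all-D v) u≢v)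
        where
        all-ordinary : ∀ e → Ordinary H e
        all-ordinary e with inhabited e
        ... | u , u∈e with other u∈e
        ... | v , v∈e , v≢u = pair-ordinary (v≢u ∘ sym) u∈e v∈e (pairs (v≢u ∘ sym) u∈e v∈e)

    -- Induction along a path of adjacencies among the neighbours of `x`: when the next vertex `z`
    -- is adjacent to `v`, both `x` and `z` are common neighbours of `u` and `v`. Then
    -- `neighbours-closed` applies at whichever of `u`, `v` lies in `Y`.
    three-neighbours⇒clique : ∀ {x t₁ t₂ t₃} → x ∈ Y → Adj x t₁ → Adj x t₂ → Adj x t₃ → t₁ ≢ t₂ → t₁ ≢ t₃ → t₂ ≢ t₃ →
      ∀ {u v} → Adj x u → Adj x v → u ≢ v → Adj u v
    three-neighbours⇒clique {x} x∈Y x₁ x₂ x₃ d₁₂ d₁₃ d₂₃ {u} {v} xu xv =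
      go (adjacency-chain nc x₁ x₂ x₃ d₁₂ d₁₃ d₂₃ (chain-of nc xu xv) xu) xu xv
      where
      nc = noncut x x∈Y
      go : ∀ {u v} → Star (λ u v → Adj x v × Adj u v) u v → Adj x u → Adj x v → u ≢ v → Adj u v
      go ε xu xv u≢v = contradiction refl u≢v
      go {u} {v} (_◅_ {j = z} (xz , uz) walk) xu xv u≢v with z ≟ᶠ v
      ... | yes refl = uz
      ... | no z≢v with go walk xz xv z≢v | neighbour-in-block x∈Y xu | neighbour-in-block x∈Y xv
      ... | zv | inj₂ u∈Y | _ = neighbours-closed (noncut u u∈Y) (adj-sym xu) uz (proj₁ xz) (u≢v ∘ sym) xv (adj-sym zv)
      ... | zv | _ | inj₂ v∈Y = adj-sym (neighbours-closed (noncut v v∈Y) (adj-sym xv) (adj-sym zv) (proj₁ xz) u≢v xu uz)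
      ... | zv | inj₁ refl | inj₁ refl = contradiction refl u≢v

  -- Blocks whose vertices in `Y` have two neighbours

  AtMostTwo : Subset (n H) → Set
  AtMostTwo Y = ∀ {x t₁ t₂ t₃} → x ∈ Y → Adj x t₁ → Adj x t₂ → Adj x t₃ → t₁ ≢ t₂ → t₁ ≢ t₃ → t₂ ≡ t₃

  another : ∀ {x f u} → Valid x f → Adj x u → ∃[ z ] (Adj x z × z ≢ u)
  another {f = f} {u} val xu =
    let z , xz , fz = neighbour val (not (f u)) in z , xz , λ z≡u → not-¬ refl (trans (cong f (sym z≡u)) fz)

  -- The value is q itself when q has no neighbour other than p.
  onwards : V → V → V
  onwards p q with any? (λ z → adj? q z ×-dec ¬? (z ≟ᶠ p))
  ... | yes (z , _) = z
  ... | no _ = q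

  onwards-spec : ∀ {p q z} → Adj q z → z ≢ p → Adj q (onwards p q) × onwards p q ≢ p
  onwards-spec {p} {q} {z} qz z≢p with any? (λ z → adj? q z ×-dec ¬? (z ≟ᶠ p))
  ... | yes (_ , ok) = ok
  ... | no none = contradiction (z , qz , z≢p) none

  -- A walk without immediate reversal; the last two vertices are stored because the next one
  -- depends on both.
  trail : V → V → ℕ → V × V
  trail u v zero = u , v
  trail u v (suc i) = proj₂ (trail u v i) , onwards (proj₁ (trail u v i)) (proj₂ (trail u v i))

  module _ {Y : Subset (n H)} (s : ℕ → V) (sep : Separated (s 0) Y) (noncut : ∀ y → y ∈ Y → Noncut y)
    (two : AtMostTwo Y) (s₁∈Y : s 1 ∈ Y) (s₀s₁ : Adj (s 0) (s 1))
    (advance : ∀ i → s (1 + i) ∈ Y → Adj (s i) (s (1 + i)) → Adj (s (1 + i)) (s (2 + i)) × s (2 + i) ≢ s i) where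

    private
      Away : ℕ → Set
      Away j = ∀ i → i < j → s (suc i) ≢ s 0

      away-≤ : ∀ {i j} → i ≤ j → Away j → Away i
      away-≤ i≤j away k k<i = away k (≤-trans k<i i≤j)

      either : ∀ {x a b d} → x ∈ Y → Adj x a → Adj x b → a ≢ b → Adj x d → d ≡ a ⊎ d ≡ b
      either {a = a} {d = d} x∈Y xa xb a≢b xd with d ≟ᶠ a
      ... | yes eq = inj₁ eq
      ... | no ne = inj₂ (sym (two x∈Y xa xb xd a≢b (ne ∘ sym)))

      along : ∀ i → Away (suc i) → s (suc i) ∈ Y × Adj (s i) (s (suc i))
      along zero away = s₁∈Y , s₀s₁
      along (suc i) away =
        let y , a = along i (away-≤ (n≤1+n _) away)
            b , _ = advance i y a
        in proj₂ (proj₂ sep) _ _ y b (away (suc i) ≤-refl) , b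

      ahead : ∀ i → Away (suc i) → Adj (s (1 + i)) (s (2 + i)) × s (2 + i) ≢ s i
      ahead i away = let y , a = along i away in advance i y a

      -- If `s (suc i)` and `s (suc j)` coincide, this vertex of `Y` has only two neighbours, so
      -- `s j` is `s i` or `s (2 + i)`. Either repetition has a smaller last index, except when `j`
      -- is `1 + i` or `2 + i`, where adjacency or the ban on reversal gives the contradiction.
      distinct : ∀ j i → i < j → Away j → s i ≢ s j
      distinct (suc j) zero lt away eq = away j ≤-refl (sym eq)
      distinct (suc j) (suc i) (s≤s i<j) away eq
        with along i (away-≤ (m≤n⇒m≤1+n i<j) away) | ahead i (away-≤ (m≤n⇒m≤1+n i<j) away) | along j away
      ... | y , a | b , b≢ | _ , z
        with either y (adj-sym a) b (b≢ ∘ sym) (subst (λ v → Adj v (s j)) (sym eq) (adj-sym z))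
      ... | inj₁ sj≡si = distinct j i i<j (away-≤ (n≤1+n j) away) (sym sj≡si)
      ... | inj₂ sj≡s2+i with <-cmp j (2 + i)
      ... | tri> _ _ 2+i<j = distinct j (2 + i) 2+i<j (away-≤ (n≤1+n j) away) (sym sj≡s2+i)
      ... | tri≈ _ refl _ = proj₂ (ahead (suc i) (away-≤ (n≤1+n _) away)) (sym eq)
      ... | tri< j<2+i _ _ with ≤-antisym i<j (≤-pred j<2+i)
      ... | refl = proj₁ z eq

      away-or-back : ∀ j → Away j ⊎ ∃[ M ] (Away M × s (suc M) ≡ s 0)
      away-or-back zero = inj₁ (λ i ())
      away-or-back (suc j) with away-or-back j
      ... | inj₂ back = inj₂ back
      ... | inj₁ away with s (suc j) ≟ᶠ s 0
      ... | yes eq = inj₂ (j , away , eq)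
      ... | no ne = inj₁ longer
        where
        longer : Away (suc j)
        longer i i<1+j with m≤n⇒m<n∨m≡n (≤-pred i<1+j)
        ... | inj₁ i<j = away i i<j
        ... | inj₂ refl = ne

      returns-after : ∃[ M ] (Away M × s (suc M) ≡ s 0)
      returns-after with away-or-back (n H)
      ... | inj₂ back = back
      ... | inj₁ away with pigeonhole ≤-refl (λ (i : Fin (suc (n H))) → s (toℕ i))
      ... | i , j , i<j , eq = contradiction eq (distinct (toℕ j) (toℕ i) i<j (away-≤ (≤-pred (toℕ<n j)) away))

      module Closed (M' : ℕ) (away : Away (2 + M')) (back : s (3 + M') ≡ s 0) {f : V → Bool} (valid : Valid (s 0) f) where
        M N : ℕ
        M = 2 + M'
        N = suc M

        on-Y : ∀ {i} → i < M → s (suc i) ∈ Y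
        on-Y {i} i<M = proj₁ (along i (away-≤ i<M away))

        consecutive : ∀ {i} → i ≤ M → Adj (s i) (s (suc i))
        consecutive {zero} _ = s₀s₁
        consecutive {suc i} i<M = proj₁ (ahead i (away-≤ i<M away))

        two-apart : ∀ {i} → i < M → s i ≢ s (2 + i)
        two-apart {i} i<M = proj₂ (ahead i (away-≤ i<M away)) ∘ sym

        in-block : ∀ {i} → i ≤ M → InBlock sep noncut (s i)
        in-block {zero} _ = inj₁ refl
        in-block {suc i} i<M = inj₂ (on-Y i<M)

        s₀sM : Adj (s 0) (s M)
        s₀sM = adj-sym (subst (Adj (s M)) back (consecutive ≤-refl))

        sM∈Y : s M ∈ Y
        sM∈Y = on-Y ≤-refl

        s₁≢sM : s 1 ≢ s M
        s₁≢sM = distinct M 1 (s≤s (s≤s z≤n)) away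

        t : ℕ
        t = w (s 0) (s 1)

        -- The edges at `x` split between its two neighbours with equal multiplicities, so each
        -- takes half of `K`.
        degree-two : ∀ {x a b} → x ∈ Y → Adj x a → Adj x b → a ≢ b → w x a + w x a ≡ K
        degree-two {x} {a} {b} x∈Y xa xb a≢b = begin
          w x a + w x a  ≡⟨ cong (w x a +_) (weight-constant (noncut x x∈Y) xa xb) ⟩
          w x a + w x b  ≡⟨ #-split (together? x a) (together? x b) (λ e → x ∈? inc H e) (λ _ → proj₁) (λ _ → proj₁) clash cover ⟨
          degree x       ≡⟨ degree≡ (proj₂ (valid-state x)) ⟩
          K              ∎
          where
          open ≡-Reasoning
          clash : ∀ e → x ∈ inc H e × a ∈ inc H e → x ∈ inc H e × b ∈ inc H e → ⊥
          clash e (x∈e , a∈e) (_ , b∈e) = a≢b (ordinary (noncut x x∈Y) x∈e a∈e (proj₁ xa ∘ sym) b∈e (proj₁ xb ∘ sym))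
          cover : ∀ e → x ∈ inc H e → (x ∈ inc H e × a ∈ inc H e) ⊎ (x ∈ inc H e × b ∈ inc H e)
          cover e x∈e with other x∈e
          ... | v , v∈e , v≢x with either x∈Y xa xb a≢b (v≢x ∘ sym , e , x∈e , v∈e)
          ... | inj₁ refl = inj₁ (x∈e , v∈e)
          ... | inj₂ refl = inj₂ (x∈e , v∈e)

        half : ∀ {i} → i < M → w (s (suc i)) (s i) + w (s (suc i)) (s i) ≡ K × w (s (suc i)) (s (2 + i)) + w (s (suc i)) (s (2 + i)) ≡ K
        half i<M = degree-two (on-Y i<M) a b (two-apart i<M) , degree-two (on-Y i<M) b a (two-apart i<M ∘ sym)
          where
          a = adj-sym (consecutive (<⇒≤ i<M))
          b = consecutive i<M

        t+t≡K : t + t ≡ K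
        t+t≡K = trans (cong (λ z → z + z) (w-sym (s 0) (s 1))) (proj₁ (half (s≤s z≤n)))

        w-consecutive : ∀ {i} → i ≤ M → w (s i) (s (suc i)) ≡ t
        w-consecutive {zero} _ = refl
        w-consecutive {suc i} i<M = double-injective (trans (proj₂ (half i<M)) (sym t+t≡K))

        -- `s 0` may be a cut vertex, but its edges to `s 1` and `s M` already number `t + t`, which
        -- is `K`; there is no room for another.
        start-neighbour : ∀ {u} → Adj (s 0) u → u ≡ s 1 ⊎ u ≡ s M
        start-neighbour {u} (s₀≢u , e , s₀∈e , u∈e) with s 1 ∈? inc H e | s M ∈? inc H e
        ... | yes s₁∈e | _ with block-pair sep noncut (inj₁ refl) (inj₂ s₁∈Y) (proj₁ s₀s₁) s₀∈e s₁∈e u u∈e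
        ...   | inj₁ u≡s₀ = contradiction (sym u≡s₀) s₀≢u
        ...   | inj₂ u≡s₁ = inj₁ u≡s₁
        start-neighbour {u} (s₀≢u , e , s₀∈e , u∈e) | no _ | yes sM∈e
          with block-pair sep noncut (inj₁ refl) (inj₂ sM∈Y) (proj₁ s₀sM) s₀∈e sM∈e u u∈e
        ...   | inj₁ u≡s₀ = contradiction (sym u≡s₀) s₀≢u
        ...   | inj₂ u≡sM = inj₂ u≡sM
        start-neighbour {u} (s₀≢u , e , s₀∈e , u∈e) | no s₁∉e | no sM∉e = contradiction (deg≤ (s 0))
          (<⇒≱ (≤-<-trans (≤-reflexive full)
            (#-disjoint-< (together? (s 0) (s 1)) (together? (s 0) (s M)) (λ e → s 0 ∈? inc H e) (λ _ → proj₁) (λ _ → proj₁)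
              clash e s₀∈e (s₁∉e ∘ proj₂) (sM∉e ∘ proj₂))))
          where
          full : K ≡ t + w (s 0) (s M)
          full = sym (trans (cong (t +_) (double-injective {w (s 0) (s M)} {t} (trans wM (sym t+t≡K)))) t+t≡K)
            where
            wM : w (s 0) (s M) + w (s 0) (s M) ≡ K
            wM = trans (cong (λ z → z + z) (w-sym (s 0) (s M)))
              (subst (λ v → w (s M) v + w (s M) v ≡ K) back (proj₂ (half ≤-refl)))
          clash : ∀ e → s 0 ∈ inc H e × s 1 ∈ inc H e → s 0 ∈ inc H e × s M ∈ inc H e → ⊥
          clash e (s₀∈e , s₁∈e) (_ , sM∈e)
            with block-pair sep noncut (inj₁ refl) (inj₂ s₁∈Y) (proj₁ s₀s₁) s₀∈e s₁∈e (s M) sM∈e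
          ... | inj₁ sM≡s₀ = proj₁ s₀sM (sym sM≡s₀)
          ... | inj₂ sM≡s₁ = s₁≢sM (sym sM≡s₁)

        CyclicNext : ℕ → ℕ → Set
        CyclicNext i j = j ≡ (i + 1) % N ⊎ i ≡ (j + 1) % N

        next-mod : ∀ {i} → i < M → suc i ≡ (i + 1) % N
        next-mod {i} i<M = trans (sym (m<n⇒m%n≡m (s≤s i<M))) (cong (_% N) (+-comm 1 i))

        wrap-mod : 0 ≡ (M + 1) % N
        wrap-mod = trans (sym (n%n≡0 N)) (cong (_% N) (+-comm 1 M))

        neighbours : ∀ {i u} → i ≤ M → Adj (s i) u → ∃[ j ] (j ≤ M × u ≡ s j × CyclicNext i j)
        neighbours {zero} _ adj with start-neighbour adj
        ... | inj₁ u≡s₁ = 1 , s≤s z≤n , u≡s₁ , inj₁ (next-mod (s≤s z≤n))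
        ... | inj₂ u≡sM = M , ≤-refl , u≡sM , inj₂ wrap-mod
        neighbours {suc i} i<M adj
          with either (on-Y i<M) (adj-sym (consecutive (<⇒≤ i<M))) (consecutive i<M) (two-apart i<M) adj
        ... | inj₁ u≡si = i , <⇒≤ i<M , u≡si , inj₂ (next-mod i<M)
        ... | inj₂ u≡s2+i with m≤n⇒m<n∨m≡n i<M
        ... | inj₁ 1+i<M = 2 + i , 1+i<M , u≡s2+i , inj₁ (next-mod 1+i<M)
        ... | inj₂ refl = 0 , z≤n , trans u≡s2+i back , inj₁ wrap-mod

        σ : Fin N → V
        σ i = s (toℕ i)

        position≤ : ∀ (i : Fin N) → toℕ i ≤ M
        position≤ i = ≤-pred (toℕ<n i)

        σ-injective : ∀ {i j} → σ i ≡ σ j → i ≡ j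
        σ-injective {i} {j} eq with <-cmp (toℕ i) (toℕ j)
        ... | tri< i<j _ _ = contradiction eq (distinct _ _ i<j (away-≤ (position≤ j) away))
        ... | tri≈ _ i≡j _ = toℕ-injective i≡j
        ... | tri> _ _ j<i = contradiction (sym eq) (distinct _ _ j<i (away-≤ (position≤ i) away))

        -- The closed trail contains all neighbours of its vertices, so connectedness makes it all
        -- of `H`.
        σ-surjective : ∀ v → ∃[ i ] v ≡ σ i
        σ-surjective = everything (λ v → any? (λ i → v ≟ᶠ σ i)) {s 0} (zero , refl) closed
          where
          closed : ∀ u v → ∃[ i ] u ≡ σ i → Adj u v → ∃[ i ] v ≡ σ i
          closed _ v (i , refl) adj with neighbours (position≤ i) adj
          ... | j , j≤M , v≡sj , _ = fromℕ< (s≤s j≤M) , trans v≡sj (cong s (sym (toℕ-fromℕ< (s≤s j≤M))))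

        step-adj : ∀ {i j} → i ≤ M → j ≡ (i + 1) % N → Adj (s i) (s j) × w (s i) (s j) ≡ t
        step-adj {i} i≤M refl with m≤n⇒m<n∨m≡n i≤M
        ... | inj₁ i<M = subst (λ j → Adj (s i) (s j) × w (s i) (s j) ≡ t) (next-mod i<M) (consecutive i≤M , w-consecutive i≤M)
        ... | inj₂ refl = subst (λ j → Adj (s M) (s j) × w (s M) (s j) ≡ t) wrap-mod
                            (subst (λ v → Adj (s M) v × w (s M) v ≡ t) back (consecutive i≤M , w-consecutive i≤M))

        cyclic-adj : ∀ {i j} → CycAdj {N} i j → Adj (σ i) (σ j) × w (σ i) (σ j) ≡ t
        cyclic-adj {i} {j} (inj₁ eq) = step-adj (position≤ i) eq
        cyclic-adj {i} {j} (inj₂ eq) = let a , e = step-adj (position≤ j) eq in adj-sym a , trans (w-sym (σ i) (σ j)) e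

        adj-cyclic : ∀ {i j} → Adj (σ i) (σ j) → CycAdj {N} i j
        adj-cyclic {i} {j} adj with neighbours (position≤ i) adj
        ... | k , k≤M , eq , next = subst (CyclicNext (toℕ i)) (trans (sym (toℕ-fromℕ< (s≤s k≤M)))
              (cong toℕ (σ-injective {fromℕ< (s≤s k≤M)} {j} (trans (cong s (toℕ-fromℕ< (s≤s k≤M))) (sym eq))))) next

        pairs : ∀ {e u v} → u ≢ v → u ∈ inc H e → v ∈ inc H e → Pair e u v
        pairs {e} {u} {v} u≢v with σ-surjective u | σ-surjective v
        ... | i , refl | j , refl = block-pair sep noncut (in-block (position≤ i)) (in-block (position≤ j)) u≢v

        all-ordinary : ∀ e → Ordinary H e
        all-ordinary e with inhabited e
        ... | u , u∈e with other u∈e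
        ... | v , v∈e , v≢u = pair-ordinary (v≢u ∘ sym) u∈e v∈e (pairs (v≢u ∘ sym) u∈e v∈e)

        opposite : ∀ {x h a b} → x ∈ Y → Valid x h → Adj x a → Adj x b → a ≢ b → h b ≡ not (h a)
        opposite {h = h} {a} x∈Y val xa xb a≢b with neighbour val (not (h a))
        ... | z , xz , hz with either x∈Y xa xb a≢b xz
        ... | inj₁ refl = contradiction hz (not-¬ refl)
        ... | inj₂ refl = hz

        -- The state after moving the token i + 1 steps along s.
        walked : ∀ i → i < M → ∃[ h ] (Valid (s (suc i)) h × h (s i) ≡ f (s (suc i)) × h (s 0) ≡ f (s 1) ×
          (∀ j → suc i < j → j ≤ M → h (s j) ≡ f (s j)))
        walked zero _ = upd f (s 0) (f (s 1)) , shift valid s₀s₁ , upd-eq f (s 0) _ , upd-eq f (s 0) _ ,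
          λ j 1<j j≤M → upd-neq f (s 0) _ (distinct j 0 (<-trans (s≤s z≤n) 1<j) (away-≤ j≤M away) ∘ sym)
        walked (suc i) 1+i<M with walked i (<⇒≤ 1+i<M)
        ... | h , val , _ , h₀ , rest = upd h (s (suc i)) (h (s (2 + i))) , shift val (consecutive (<⇒≤ 1+i<M)) ,
          trans (upd-eq h _ _) (rest (2 + i) ≤-refl 1+i<M) ,
          trans (upd-neq h _ _ (distinct (suc i) 0 (s≤s z≤n) (away-≤ (<⇒≤ 1+i<M) away))) h₀ ,
          λ j lt j≤M → trans (upd-neq h _ _ (distinct j (suc i) (<⇒≤ lt) (away-≤ j≤M away) ∘ sym)) (rest j (<⇒≤ lt) j≤M)

        -- With the token on `s (suc i)`, its two neighbours have opposite colours; the one behind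
        -- carries `f (s (suc i))`, the one ahead still its original colour.
        alternates : ∀ i → suc i < M → f (s (2 + i)) ≡ not (f (s (suc i)))
        alternates i 1+i<M with walked i (<⇒≤ 1+i<M)
        ... | h , val , hi , _ , rest = trans (sym (rest (2 + i) ≤-refl 1+i<M)) (trans
              (opposite (on-Y (<⇒≤ 1+i<M)) val (adj-sym (consecutive (<⇒≤ (<⇒≤ 1+i<M)))) (consecutive (<⇒≤ 1+i<M)) (two-apart (<⇒≤ 1+i<M)))
              (cong not hi))

        -- With the token on `s M`, the neighbour `s 0` carries `f (s 1)` and the neighbour behind
        -- carries `f (s M)`. Alternation then makes `M - 1` odd, and so `N`.
        ends-differ : f (s M) ≢ f (s 1)
        ends-differ eq with walked (suc M') ≤-refl
        ... | h , val , hi , h₀ , _ = not-¬ (trans h₀ (trans (sym eq) (sym hi)))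
              (opposite sM∈Y val (adj-sym (consecutive (n≤1+n _))) (adj-sym s₀sM)
                (distinct (suc M') 0 (s≤s z≤n) (away-≤ (n≤1+n _) away) ∘ sym))

        colour-at : ∀ i → i < M → f (s (suc i)) ≡ flip-colour i (f (s 1))
        colour-at zero _ = refl
        colour-at (suc i) 1+i<M = trans (alternates i 1+i<M) (cong not (colour-at i (<⇒≤ 1+i<M)))

        tC : IsTC H t N
        tC = s≤s (s≤s (s≤s z≤n)) , all-ordinary , σ ,
          (σ-injective , λ v → let i , eq = σ-surjective v in i , λ { refl → sym eq }) ,
          λ i j → (λ cyc → let a , e = cyclic-adj {i} {j} cyc in trans (mult≡w (pairs (proj₁ a))) e) ,
                  (λ ¬cyc → mult≡0 (¬cyc ∘ adj-cyclic {i} {j}))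

        odd : Odd N
        odd = flip-odd (suc M') (λ eq → ends-differ (trans (colour-at (suc M') ≤-refl) eq))

    closed-trail⇒tC : ∀ {f} → Valid (s 0) f → ∃[ t ] ∃[ N ] (1 ≤ t × Odd N × 3 ≤ N × IsTC H t N)
    closed-trail⇒tC val with returns-after
    -- Returning after one or two steps would be a loop or an immediate reversal.
    ... | zero , away , back = contradiction (sym back) (proj₁ s₀s₁)
    ... | suc zero , away , back = contradiction back (proj₂ (ahead 0 away))
    ... | suc (suc M') , away , back = t , N , w-positive s₀s₁ , odd , s≤s (s≤s (s≤s z≤n)) , tC
      where open Closed M' away back val

  two-neighbours⇒tC : ∀ {c Y v f} → Separated c Y → (∀ y → y ∈ Y → Noncut y) → AtMostTwo Y → Valid c f →
    v ∈ Y → Adj c v → ∃[ t ] ∃[ N ] (1 ≤ t × Odd N × 3 ≤ N × IsTC H t N)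
  two-neighbours⇒tC {c} {v = v} sep noncut two val v∈Y cv =
    closed-trail⇒tC (λ i → proj₁ (trail c v i)) sep noncut two v∈Y cv advance val
    where
    advance : ∀ i → proj₁ (trail c v (1 + i)) ∈ _ → Adj (proj₁ (trail c v i)) (proj₁ (trail c v (1 + i))) →
      Adj (proj₁ (trail c v (1 + i))) (proj₁ (trail c v (2 + i))) × proj₁ (trail c v (2 + i)) ≢ proj₁ (trail c v i)
    advance i _ adj = let z , qz , z≢p = another (proj₂ (valid-state _)) (adj-sym adj) in onwards-spec qz z≢p

  -- From an end block to the exceptional hypergraphs

  Exceptional : Set
  Exceptional = (∃[ t ] (1 ≤ t × IsTK H t (n H))) ⊎ (∃[ t ] ∃[ N ] (1 ≤ t × Odd N × 3 ≤ N × IsTC H t N))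

  block⇒exceptional : ∀ {c Y f} → Separated c Y → (∀ y → y ∈ Y → Noncut y) → Valid c f → Exceptional
  block⇒exceptional {c} {Y} {f} sep noncut val
    with any? (λ x → any? (λ t₁ → any? (λ t₂ → any? (λ t₃ → (x ∈? Y) ×-dec
      ((adj? x t₁ ×-dec (adj? x t₂ ×-dec adj? x t₃)) ×-dec
       (¬? (t₁ ≟ᶠ t₂) ×-dec (¬? (t₁ ≟ᶠ t₃) ×-dec ¬? (t₂ ≟ᶠ t₃))))))))
  ... | yes (x , t₁ , t₂ , t₃ , x∈Y , (x₁ , x₂ , x₃) , d₁₂ , d₁₃ , d₂₃) = inj₁
        (clique⇒tK sep noncut x∈Y x₁ (three-neighbours⇒clique sep noncut x∈Y x₁ x₂ x₃ d₁₂ d₁₃ d₂₃))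
  ... | no none with proj₂ conn Y (proj₁ (proj₂ sep)) (c , proj₁ sep)
  ... | e , (v , v∈e , v∈Y) , (u , u∈e , u∉Y) = inj₂ (two-neighbours⇒tC sep noncut two val v∈Y cv)
    where
    two : AtMostTwo Y
    two {x} {t₁} {t₂} {t₃} x∈Y x₁ x₂ x₃ d₁₂ d₁₃ with t₂ ≟ᶠ t₃
    ... | yes eq = eq
    ... | no d₂₃ = contradiction (x , t₁ , t₂ , t₃ , x∈Y , (x₁ , x₂ , x₃) , d₁₂ , d₁₃ , d₂₃) none
    vu : Adj v u
    vu = (λ { refl → u∉Y v∈Y }) , e , v∈e , u∈e
    cv : Adj c v
    cv with u ≟ᶠ c
    ... | yes refl = adj-sym vu
    ... | no u≢c = contradiction (proj₂ (proj₂ sep) v u v∈Y vu u≢c) u∉Y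

  -- The descent to an end block starts from all vertices but `root`; it argues by contradiction,
  -- hence the double negation.
  ¬¬exceptional : ¬ ¬ Exceptional
  ¬¬exceptional ¬exc = end-block {root} {⟦ ≠? root ⟧} sep
    (λ c Y sep noncut → ¬exc (block⇒exceptional sep noncut (proj₂ (valid-state c))))
    where
    root : V
    root = fromℕ< (proj₁ conn)
    sep : Separated root ⟦ ≠? root ⟧
    sep = (λ r∈ → ∈⟦⟧⁻ (≠? root) r∈ refl) ,
      (let z , rz , _ = neighbour (proj₂ (valid-state root)) true in z , ∈⟦⟧⁺ (≠? root) (proj₁ rz ∘ sym)) ,
      λ y v _ _ v≢r → ∈⟦⟧⁺ (≠? root) v≢r

theorem3 : (H : Hypergraph) → Connected H → 1 ≤ maxDeg H →
    (∀ (t N : ℕ) → 1 ≤ t → 1 ≤ N → ¬ IsTK H t N) →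
    (∀ (t N : ℕ) → 1 ≤ t → Odd N → 3 ≤ N → ¬ IsTC H t N) →
    (p : ℕ) → 2 ≤ p → (k : Fin p → ℕ) → (∀ i → 1 ≤ k i) →
    sumFin p k ≥ maxDeg H →
    ∃[ f ] (∀ (i : Fin p) →
    ColLe H (part {n H} {p} f i) (k i) × MaxDegInducedLe H (part {n H} {p} f i) (k i))
theorem3 H conn _ ¬tK ¬tC (suc (suc p)) (s≤s (s≤s z≤n)) k k≥1 sum≥ = conclude (partition-search κ)
  where
  open Hyper H
  open Parts H
  open Decide H
  -- The colour `true` stands for the first part, `false` for all the others merged.
  κ : Bool → ℕ
  κ = sizes (k zero) (sumFin (suc p) (k ∘ suc))
  open Split κ
  κ≥1 : ∀ c → 1 ≤ κ c
  κ≥1 true = k≥1 zero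
  κ≥1 false = ≤-trans (≤-trans (k≥1 (suc zero)) (m≤m+n _ _)) (≤-reflexive (sym (sumFin-suc p (k ∘ suc))))
  deg≤ : ∀ v → Adjacency.degree H v ≤ κ true + κ false
  deg≤ v = ≤-trans (degree≤maxDeg H v) (≤-trans sum≥ (≤-reflexive (sumFin-suc (suc p) k)))
  conclude : (∃[ f ] Partition (_∈ ⊤) f) ⊎ (∀ f X → (∀ v → X v) → ¬ Partition X f) →
    ∃[ f ] (∀ i → ColLe H (part f i) (k i) × MaxDegInducedLe H (part f i) (k i))
  conclude (inj₁ (f , P)) =
    let g , Q , Δ = improve ⊤ (λ v _ → ≤-trans (#-mono (near? (_∈? ⊤) v) (λ e → v ∈? inc H e) (λ _ → proj₁)) (deg≤ v)) f P
        h , B = refine p k ⊤ g (class-bounded _ _ ⊤ g Q Δ)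
    in h , λ i → bounded⇒ h i (k i) (bounded-⊆ (λ v → (v ∈? ⊤) ×-dec (h v ≟ᶠ i)) (λ v eq → ∈⊤ , eq) (B i))
  conclude (inj₂ stuck) = ⊥-elim (Game.¬¬exceptional H conn κ κ≥1 deg≤ stuck λ
    { (inj₁ (t , t≥1 , tK)) → ¬tK t (n H) t≥1 (proj₁ conn) tK
    ; (inj₂ (t , N , t≥1 , odd , N≥3 , tC)) → ¬tC t N t≥1 odd N≥3 tC })
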